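{- Let $H_1$ be the digraph on vertices $a,b,c,d$ with arc set $\{(a,b),(b,a),(b,c),(c,b),(c,d),(d,a)\}$, and let $H_2$ be the digraph on vertices $a,b,c,d$ with arc set $\{(a,b),(b,a),(b,c),(c,b),(c,d),(a,d)\}$. Then $\mathrm{mader}_{\overrightarrow{\chi}}(H_1)=\mathrm{mader}_{\overrightarrow{\chi}}(H_2)=4$.
   Context: An acyclic $k$-coloring of a digraph $D$ is a map $c:V(D)\to\{1,\ldots,k\}$ whose color classes each induce a subdigraph with no directed cycle; $\overrightarrow{\chi}(D)$ is the least such $k$. A subdivision of a digraph $H$ is obtained by replacing each arc $(u,v)$ by a directed $u$–$v$ path, the paths internally vertex-disjoint from each other and from $V(H)$. $\mathrm{mader}_{\overrightarrow{\chi}}(H)$ is the smallest integer $m$ such that every digraph $D$ with $\overrightarrow{\chi}(D)\ge m$ contains a subdivision of $H$. Thus $H_1$ and $H_2$ are subdigraphs of the biorientation of the 4-cycle $abcd$ consisting of two digons sharing the vertex $b$ together with, respectively, a directed path $c\to d\to a$ (for $H_1$) or two arcs entering $d$ (for $H_2$). -}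

module Defs where

open import Data.Nat using (ℕ; _<_; _≤_)
open import Data.Fin using (Fin; zero; suc)
open import Data.Bool using (Bool; true; false)
open import Data.List using (List; []; _∷_)
open import Data.List.Relation.Unary.All using (All)
open import Data.List.Relation.Unary.Unique.Propositional using (Unique)
open import Data.List.Membership.Propositional using (_∈_; _∉_)
open import Data.Product using (Σ; _×_)
open import Relation.Binary.PropositionalEquality using (_≡_; _≢_)
open import Relation.Nullary using (¬_)

record Digraph : Set where
  field
    size     : ℕ
    arc      : Fin size → Fin size → Bool
    loopless : ∀ v → arc v v ≡ false
open Digraph public

V : Digraph → Set
V D = Fin (size D)

Arc : (D : Digraph) → V D → V D → Set
Arc D u v = arc D u v ≡ true

Walk : (D : Digraph) → V D → List (V D) → V D → Set
Walk D x []       y = Arc D x y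
Walk D x (z ∷ zs) y = Arc D x z × Walk D z zs y

DirectedCycle : (D : Digraph) → V D → List (V D) → Set
DirectedCycle D x xs = Walk D x xs x × Unique (x ∷ xs)

IsAcyclicColoring : (D : Digraph) (k : ℕ) → (V D → Fin k) → Set
IsAcyclicColoring D k c =
  ∀ x xs → DirectedCycle D x xs → ¬ All (λ w → c w ≡ c x) xs

AcyclicColorable : Digraph → ℕ → Set
AcyclicColorable D k = Σ (V D → Fin k) (IsAcyclicColoring D k)

IsDichromaticNumber : Digraph → ℕ → Set
IsDichromaticNumber D k =
  AcyclicColorable D k × (∀ j → j < k → ¬ AcyclicColorable D j)

record Subdivision (H D : Digraph) : Set where
  field
    φ         : V H → V D
    φ-inj     : ∀ u v → φ u ≡ φ v → u ≡ v
    path      : V H → V H → List (V D)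
    path-walk : ∀ u v → Arc H u v → Walk D (φ u) (path u v) (φ v)
    path-uniq : ∀ u v → Arc H u v → Unique (path u v)
    path-avoid : ∀ u v → Arc H u v → ∀ w → w ∈ path u v → ∀ h → w ≢ φ h
    path-disj : ∀ u v u' v' → Arc H u v → Arc H u' v' →
                ¬ (u ≡ u' × v ≡ v') →
                ∀ w → w ∈ path u v → w ∉ path u' v'

MaderProperty : Digraph → ℕ → Set
MaderProperty H m =
  (D : Digraph) (k : ℕ) → IsDichromaticNumber D k → m ≤ k → Subdivision H D

IsMaderChi : Digraph → ℕ → Set
IsMaderChi H m = MaderProperty H m × (∀ m' → MaderProperty H m' → m ≤ m')

a b c d : Fin 4
a = zero
b = suc zero
c = suc (suc zero)
d = suc (suc (suc zero))

arcH₁ : Fin 4 → Fin 4 → Bool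
arcH₁ zero (suc zero) = true
arcH₁ (suc zero) zero = true
arcH₁ (suc zero) (suc (suc zero)) = true
arcH₁ (suc (suc zero)) (suc zero) = true
arcH₁ (suc (suc zero)) (suc (suc (suc zero))) = true
arcH₁ (suc (suc (suc zero))) zero = true
arcH₁ _ _ = false

arcH₂ : Fin 4 → Fin 4 → Bool
arcH₂ zero (suc zero) = true
arcH₂ (suc zero) zero = true
arcH₂ (suc zero) (suc (suc zero)) = true
arcH₂ (suc (suc zero)) (suc zero) = true
arcH₂ (suc (suc zero)) (suc (suc (suc zero))) = true
arcH₂ zero (suc (suc (suc zero))) = true
arcH₂ _ _ = false

H₁ : Digraph
H₁ = record { size = 4 ; arc = arcH₁ ; loopless = ll }
  where
  ll : ∀ v → arcH₁ v v ≡ false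
  ll zero = Relation.Binary.PropositionalEquality.refl
  ll (suc zero) = Relation.Binary.PropositionalEquality.refl
  ll (suc (suc zero)) = Relation.Binary.PropositionalEquality.refl
  ll (suc (suc (suc zero))) = Relation.Binary.PropositionalEquality.refl

H₂ : Digraph
H₂ = record { size = 4 ; arc = arcH₂ ; loopless = ll }
  where
  ll : ∀ v → arcH₂ v v ≡ false
  ll zero = Relation.Binary.PropositionalEquality.refl
  ll (suc zero) = Relation.Binary.PropositionalEquality.refl
  ll (suc (suc zero)) = Relation.Binary.PropositionalEquality.refl
  ll (suc (suc (suc zero))) = Relation.Binary.PropositionalEquality.refl

{-# OPTIONS --safe #-}

-- The complete digraph on m vertices has dichromatic number m and no room for a subdivision when m < 4.
--
-- For the upper bound let W be a minimal non-3-colourable vertex set. It is strongly connected, and a nonempty S ⊂ W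
-- whose arcs leave S only towards one vertex x is not 2-colourable, since otherwise S could be coloured avoiding the
-- colour of x. Let T be a minimal such S. By minimality every vertex of T reaches x in T while avoiding any other
-- given vertex.
--
-- H₂: T has a low-high order, i.e. a linear order in which every vertex has a smaller out-neighbour and a larger one,
-- with x counting as both. If some v is the largest vertex of one cycle in T and the smallest of another, then
-- descending from the minimum of the first and ascending from the maximum of the second yields two disjoint paths to x,
-- which together with the two cycles form a subdivision of H₂ with b = v and d = x. If there is no such v, then
-- colouring the vertices by whether they are the largest of some cycle is an acyclic 2-colouring of T.
--
-- H₁: there is q ∈ T such that x reaches all of W − q inside W − q. A 3-colouring of W − q yields three cycles through
-- q, disjoint otherwise, one in each colour. In W − q the first vertex of each reaches x, so some walk meets all three.
-- It contains a path from one cycle to another with an inner vertex, and the three together form a subdivision of H₁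
-- with b = q.
module Submission where

open import Defs
open import Data.Bool using (Bool; true; false)
import Data.Bool.Properties as Bool
open import Data.Empty using (⊥; ⊥-elim)
open import Data.Fin using (Fin; zero; suc; _≟_; punchIn; combine; quotient; remainder)
open import Data.Fin.Properties using (any?; all?; ¬∀⟶∃¬; pigeonhole; injective⇒≤; punchIn-injective; punchInᵢ≢i; combine-injective; combine-remQuot; remQuot-combine)
open import Data.Fin.Subset using (Subset; _⊂_; _∪_; _∩_; ⁅_⁆) renaming (_∈_ to _∈ₛ_; _∉_ to _∉ₛ_; _⊆_ to _⊆ₛ_; ⊤ to ⊤ₛ)
open import Data.Fin.Subset.Induction using (⊂-wellFounded)
open import Data.Fin.Subset.Properties using (x∈p∪q⁺; x∈p∪q⁻; x∈p∩q⁺; x∈p∩q⁻; x∈⁅x⁆; x∈⁅y⁆⇒x≡y; nonempty?; ∈⊤) renaming (_∈?_ to _∈ₛ?_)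
open import Data.List using (List; []; _∷_; _++_; map; filter; length; lookup; allFin)
open import Data.List.Membership.Propositional using (_∈_; _∉_; find; lose)
open import Data.List.Membership.Propositional.Properties using (∈-∃++; ∈-++⁺ˡ; ∈-++⁺ʳ; ∈-++⁻; ∈-insert; ∈-map⁺; ∈-lookup; ∈-allFin; ∈-filter⁺; ∈-filter⁻)
import Data.List.Membership.DecPropositional as DecMembership
open import Data.List.Properties using (map-++; map-∘; map-id)
open import Data.List.Relation.Binary.Subset.Propositional using (_⊆_)
open import Data.List.Relation.Unary.All as All using (All; []; _∷_)
import Data.List.Relation.Unary.All.Properties as All
open import Data.List.Relation.Unary.AllPairs using ([]; _∷_)
open import Data.List.Relation.Unary.Any as Any using (Any; here; there)
open import Data.List.Relation.Unary.Unique.Propositional using (Unique)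
import Data.List.Relation.Unary.Unique.Propositional.Properties as Unique
import Data.List.Relation.Unary.Unique.DecPropositional as DecUnique
open import Data.Nat using (ℕ; zero; suc; _≤_; _≥_; _<_; _>_; z≤n; s≤s; _*_; _∸_; _⊔_)
open import Data.Nat.Induction using (<-wellFounded)
open import Data.Nat.Properties using (≤-refl; ≤-reflexive; ≤-trans; ≤-total; <-trans; <-irrefl; <-asym; <-cmp; ≤∧≢⇒<; ≤⇒≯; <⇒≤; n≤1+n; m<n⇒m<1+n; m≤m⊔n; m≤n⊔m; suc-injective; ∸-monoʳ-<; *-monoʳ-≤; *-suc; *-cancelˡ-≡; even≢odd)
open import Data.Product using (∃; ∃₂; _×_; _,_; proj₁; proj₂)
open import Data.Sum using (_⊎_; inj₁; inj₂; [_,_]′)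
open import Data.Sum.Properties using (inj₁-injective; inj₂-injective)
open import Data.Unit using (⊤; tt)
open import Data.Vec using (tabulate)
open import Data.Vec.Properties using (lookup∘tabulate; lookup⇒[]=; []=⇒lookup)
open import Function using (_∘_; id; flip)
open import Induction.WellFounded using (Acc; acc)
open import Relation.Binary using (tri<; tri≈; tri>)
open import Relation.Binary.PropositionalEquality using (_≡_; _≢_; refl; sym; trans; cong; cong₂; subst; subst₂)
open import Relation.Nullary using (¬_; Dec; yes; no; does; contradiction; ¬?; _×-dec_; _⊎-dec_; _→-dec_)
open import Relation.Nullary.Decidable using (map′; dec-true; decidable-stable; ¬¬-excluded-middle)
open import Relation.Unary using (Decidable)


-- Classical reasoning takes place under a double negation, which is removed at the end because Subdivision H D is decidable.

DN : Set → Set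
DN A = ¬ ¬ A

return : {A : Set} → A → DN A
return x k = k x

infixl 1 _>>=_
_>>=_ : {A B : Set} → DN A → (A → DN B) → DN B
(m >>= f) k = m (λ x → f x k)

em : {A : Set} → DN (Dec A)
em = ¬¬-excluded-middle

-- The index type is finite, so the double negations are discharged one after another. This allows
-- decisions or cycles to be chosen for all indices at once.
DN-∀ : ∀ {n} {P : Fin n → Set} → (∀ i → DN (P i)) → DN (∀ i → P i)
DN-∀ {zero}  f = return λ ()
DN-∀ {suc n} f = do
  p  ← f zero
  ps ← DN-∀ (f ∘ suc)
  return λ { zero → p ; (suc i) → ps i }

-- Finite subsets and minimality

module _ {n : ℕ} {P : Fin n → Set} (P? : Decidable P) where

  select : Subset n
  select = tabulate (does ∘ P?)

  ∈-select⁺ : ∀ {i} → P i → i ∈ₛ select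
  ∈-select⁺ {i} p = lookup⇒[]= i select (trans (lookup∘tabulate _ i) (dec-true (P? i) p))

  ∈-select⁻ : ∀ {i} → i ∈ₛ select → P i
  ∈-select⁻ {i} i∈ with P? i | trans (sym (lookup∘tabulate (does ∘ P?) i)) ([]=⇒lookup i∈)
  ... | yes p | _ = p

-- Excluded middle at each index turns an arbitrary predicate, such as reachability, into a
-- `Subset`.
comprehension : ∀ {n} (P : Fin n → Set) → DN (∃ λ S → (∀ i → P i → i ∈ₛ S) × (∀ i → i ∈ₛ S → P i))
comprehension P = do
  P? ← DN-∀ (λ i → em {P i})
  return (select P? , (λ _ → ∈-select⁺ P?) , (λ _ → ∈-select⁻ P?))

other? : ∀ {n} (S : Subset n) (v : Fin n) → Decidable (λ u → u ∈ₛ S × u ≢ v)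
other? S v u = u ∈ₛ? S ×-dec ¬? (u ≟ v)

infixl 5 _∖_
_∖_ : ∀ {n} → Subset n → Fin n → Subset n
S ∖ v = select (other? S v)

module _ {n : ℕ} {S : Subset n} {v : Fin n} where

  ∈-∖⁺ : ∀ {u} → u ∈ₛ S → u ≢ v → u ∈ₛ S ∖ v
  ∈-∖⁺ u∈S u≢v = ∈-select⁺ (other? S v) (u∈S , u≢v)

  ∈-∖⁻ : ∀ {u} → u ∈ₛ S ∖ v → u ∈ₛ S × u ≢ v
  ∈-∖⁻ = ∈-select⁻ (other? S v)

  ∖-⊂ : v ∈ₛ S → S ∖ v ⊂ S
  ∖-⊂ v∈S = (proj₁ ∘ ∈-∖⁻) , v , v∈S , λ v∈ → proj₂ (∈-∖⁻ v∈) refl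

IsMinimal : ∀ {n} → (Subset n → Set) → Subset n → Set
IsMinimal P S = P S × (∀ S' → S' ⊂ S → ¬ P S')

minimal : ∀ {n} (P : Subset n → Set) S → P S → DN (∃ (IsMinimal P))
minimal P S = go S (⊂-wellFounded S)
  where
  go : ∀ S → Acc _⊂_ S → P S → DN (∃ (IsMinimal P))
  go S (acc rs) p = do
    no none ← em {∃ λ S' → S' ⊂ S × P S'}
      where yes (S' , S'⊂S , p') → go S' (rs S'⊂S) p'
    return (S , p , λ S' S'⊂S p' → none (S' , S'⊂S , p'))

-- Lists without repetition

Unique-++⁻ʳ : {A : Set} (xs : List A) {ys : List A} → Unique (xs ++ ys) → Unique ys
Unique-++⁻ʳ []       u       = u
Unique-++⁻ʳ (x ∷ xs) (_ ∷ u) = Unique-++⁻ʳ xs u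

∷-unique : {A : Set} {x : A} {xs : List A} → x ∉ xs → Unique xs → Unique (x ∷ xs)
∷-unique x∉xs u = All.tabulate (λ y∈ x≡y → x∉xs (subst (_∈ _) (sym x≡y) y∈)) ∷ u

unique-head : {A : Set} {x : A} {xs : List A} → Unique (x ∷ xs) → x ∉ xs
unique-head (x≢ ∷ _) x∈ = All.lookup x≢ x∈ refl

unique-constant : {A : Set} {x : A} {xs : List A} → Unique (x ∷ xs) → All (_≡ x) xs → xs ≡ []
unique-constant u []       = refl
unique-constant u (y≡x ∷ _) = contradiction (here (sym y≡x)) (unique-head u)

-- Walks and directed cycles

module _ (D : Digraph) where

  open DecMembership (_≟_ {size D}) using (_∈?_)

  arc-irrefl : ∀ {v} → ¬ Arc D v v
  arc-irrefl {v} a with () ← trans (sym a) (loopless D v)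

  arc? : ∀ u v → Dec (Arc D u v)
  arc? u v = arc D u v Bool.≟ true

  walk? : ∀ u xs v → Dec (Walk D u xs v)
  walk? u []       v = arc? u v
  walk? u (x ∷ xs) v = arc? u x ×-dec walk? x xs v

  walk-++ : ∀ {u} xs {v ys w} → Walk D u xs v → Walk D v ys w → Walk D u (xs ++ v ∷ ys) w
  walk-++ []       a       q = a , q
  walk-++ (x ∷ xs) (a , p) q = a , walk-++ xs p q

  walk-++⁻ : ∀ {u} xs {v ys w} → Walk D u (xs ++ v ∷ ys) w → Walk D u xs v × Walk D v ys w
  walk-++⁻ []       (a , q) = a , q
  walk-++⁻ (x ∷ xs) (a , p) with p' , q ← walk-++⁻ xs p = (a , p') , q

  -- The tail is erased first; if `u` recurs on the result, everything before that occurrence is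
  -- dropped. Because of `ys ⊆ xs`, whatever the walk avoids is still avoided.
  loop-erase : ∀ {u} xs {v} → Walk D u xs v → ∃ λ ys → Walk D u ys v × Unique (u ∷ ys) × ys ⊆ xs
  loop-erase         []       p = [] , p , [] ∷ [] , id
  loop-erase {u} (x ∷ xs) (a , p) with ys , q , uniq , ys⊆xs ← loop-erase xs p | u ∈? (x ∷ ys)
  ... | no u∉ = x ∷ ys , (a , q) , ∷-unique u∉ uniq , λ { (here e) → here e ; (there m) → there (ys⊆xs m) }
  ... | yes u∈ with ps , qs , e ← ∈-∃++ u∈ =
    qs , proj₂ (walk-++⁻ ps (subst (λ l → Walk D u l _) e (a , q))) , Unique-++⁻ʳ ps (subst Unique e uniq) ,
    λ m → weaken (subst (_ ∈_) (sym e) (∈-++⁺ʳ ps (there m)))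
    where
    weaken : ∀ {z} → z ∈ x ∷ ys → z ∈ x ∷ xs
    weaken (here e)  = here e
    weaken (there m) = there (ys⊆xs m)

  rotate : ∀ {x xs w} → Walk D x xs x → w ∈ x ∷ xs → ∃ λ ys → Walk D w ys w × ys ⊆ x ∷ xs
  rotate {xs = xs} p (here refl) = xs , p , there
  rotate {x} p (there w∈) with ps , qs , refl ← ∈-∃++ w∈ with p₁ , p₂ ← walk-++⁻ ps p =
    qs ++ x ∷ ps , walk-++ qs p₂ p₁ , λ m → [ (λ m' → there (∈-++⁺ʳ ps (there m'))) , (λ { (here e) → here e ; (there m') → there (∈-++⁺ˡ m') }) ]′ (∈-++⁻ qs m)

  -- Uniqueness is not carried through the rotation but restored by loop erasure. The cycle might
  -- shrink a priori, but only the inclusion of its vertices is ever needed.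
  rotate-cycle : ∀ {x xs w} → DirectedCycle D x xs → w ∈ x ∷ xs → ∃ λ ys → DirectedCycle D w ys × ys ⊆ x ∷ xs
  rotate-cycle (p , _) w∈ with ys , q , ys⊆ ← rotate p w∈ with zs , q' , uniq , zs⊆ ← loop-erase ys q =
    zs , (q' , uniq) , ys⊆ ∘ zs⊆

  -- `P` stands for lying on a given cycle, so that `S` need be closed only along arcs between
  -- vertices of that cycle.
  walk-stays : ∀ {S : Subset (size D)} {P : V D → Set} →
               (∀ {u v} → u ∈ₛ S → P u → P v → Arc D u v → v ∈ₛ S) →
               ∀ {u} xs {v} → u ∈ₛ S → P u → All P xs → Walk D u xs v → All (_∈ₛ S) xs
  walk-stays closed []       u∈ pu _         _       = []
  walk-stays closed (x ∷ xs) u∈ pu (px ∷ ps) (a , p) = x∈ ∷ walk-stays closed xs x∈ px ps p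
    where x∈ = closed u∈ pu px a

  -- Acyclic colourings and critical vertex sets

  Colours : ∀ {k} → Subset (size D) → (V D → Fin k) → Set
  Colours S c = ∀ x xs → DirectedCycle D x xs → All (_∈ₛ S) (x ∷ xs) → ¬ All (λ w → c w ≡ c x) xs

  Colourable : ℕ → Subset (size D) → Set
  Colourable k S = ∃ λ (c : V D → Fin k) → Colours S c

  -- A monochromatic cycle of the glued colouring cannot leave S, since every exit arc is bichromatic.
  module _ {k} {S W : Subset (size D)} {c₁ c₂ : V D → Fin k} where

    glue : V D → Fin k
    glue v with v ∈ₛ? S
    ... | yes _ = c₁ v
    ... | no  _ = c₂ v

    glue-∈ : ∀ {v} → v ∈ₛ S → glue v ≡ c₁ v
    glue-∈ {v} v∈ with v ∈ₛ? S
    ... | yes _ = refl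
    ... | no v∉ = contradiction v∈ v∉

    glue-∉ : ∀ {v} → v ∉ₛ S → glue v ≡ c₂ v
    glue-∉ {v} v∉ with v ∈ₛ? S
    ... | yes v∈ = contradiction v∈ v∉
    ... | no _   = refl

    glue-colours : Colours S c₁ → ∀ {S'} → (∀ {v} → v ∈ₛ W → v ∉ₛ S → v ∈ₛ S') → Colours S' c₂ →
                   (∀ {u v} → u ∈ₛ S → v ∈ₛ W → v ∉ₛ S → Arc D u v → c₁ u ≢ c₂ v) → Colours W glue
    glue-colours col₁ W∖S⊆S' col₂ exits x xs cyc inW mono with Any.any? (_∈ₛ? S) (x ∷ xs)
    ... | yes some with t , t∈ , t∈S ← find some with ys , (p , uniq) , ys⊆ ← rotate-cycle cyc t∈ =
      col₁ t ys (p , uniq) (t∈S ∷ ysS)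
        (All.tabulate λ m → trans (sym (glue-∈ (All.lookup ysS m))) (trans (same (ys⊆ m)) (trans (sym (same t∈)) (glue-∈ t∈S))))
      where
      same : ∀ {w} → w ∈ x ∷ xs → glue w ≡ glue x
      same (here refl) = refl
      same (there m)   = All.lookup mono m
      P : V D → Set
      P w = w ∈ x ∷ xs
      closed : ∀ {u v} → u ∈ₛ S → P u → P v → Arc D u v → v ∈ₛ S
      closed {u} {v} u∈ pu pv a with v ∈ₛ? S
      ... | yes v∈ = v∈
      ... | no v∉  = contradiction (trans (sym (glue-∈ u∈)) (trans (same pu) (trans (sym (same pv)) (glue-∉ v∉))))
                                   (exits u∈ (All.lookup inW pv) v∉ a)
      ysS : All (_∈ₛ S) ys
      ysS = walk-stays closed ys t∈S t∈ (All.tabulate ys⊆) p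
    ... | no none = col₂ x xs cyc (All.tabulate λ m → W∖S⊆S' (All.lookup inW m) (out m))
        (All.tabulate λ m → trans (sym (glue-∉ (out (there m)))) (trans (All.lookup mono m) (glue-∉ (out (here refl)))))
      where
      out : ∀ {w} → w ∈ x ∷ xs → w ∉ₛ S
      out m w∈ = none (lose m w∈)

  -- For `k ≥ 1` such a set induces a vertex-critical digraph of dichromatic number `k + 1`.
  Critical : ℕ → Subset (size D) → Set
  Critical k = IsMinimal (λ S → ¬ Colourable k S)

  critical-proper : ∀ {k W} → Critical k W → ∀ {S} → S ⊂ W → DN (Colourable k S)
  critical-proper (_ , min) S⊂W = min _ S⊂W

  OnlyExit : (S W : Subset (size D)) → V D → Set
  OnlyExit S W x = ∀ {u v} → u ∈ₛ S → v ∈ₛ W → Arc D u v → v ∈ₛ S ⊎ v ≡ x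

  module _ {k} {W : Subset (size D)} (crit : Critical k W) where

    -- Strong connectivity of `W` in terms of cuts. If no arc left `S`, colourings of the proper
    -- subsets `S` and `W ∖ S` could be glued with no exit arc to check.
    critical-exit : ∀ {S} → S ⊆ₛ W → ∀ {s t} → s ∈ₛ S → t ∈ₛ W → t ∉ₛ S →
                    ¬ (∀ {u v} → u ∈ₛ S → v ∈ₛ W → Arc D u v → v ∈ₛ S)
    critical-exit {S} S⊆W {s} {t} s∈S t∈W t∉S closed = (do
      c₁ , col₁ ← critical-proper crit {S} ((λ m → S⊆W m) , t , t∈W , t∉S)
      c₂ , col₂ ← critical-proper crit {W∖S} ((λ m → proj₁ (∈-select⁻ W∖S? m)) , s , S⊆W s∈S , λ m → proj₂ (∈-select⁻ W∖S? m) s∈S)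
      return (proj₁ crit (_ , glue-colours col₁ (λ v∈ v∉ → ∈-select⁺ W∖S? (v∈ , v∉)) col₂
        λ u∈ v∈ v∉ a _ → v∉ (closed u∈ v∈ a)))) id
      where
      W∖S? = λ v → v ∈ₛ? W ×-dec ¬? (v ∈ₛ? S)
      W∖S  = select W∖S?

  one-exit-not-colourable : ∀ {k W} → Critical (suc k) W → ∀ {S x s} → S ⊆ₛ W → s ∈ₛ S → OnlyExit S W x → ¬ Colourable k S
  one-exit-not-colourable {k} {W} crit {S} {x} {s} S⊆W s∈S exit (c₁ , col₁) = (do
      c₂ , col₂ ← critical-proper crit {W∖S} ((λ m → proj₁ (∈-select⁻ W∖S? m)) , s , S⊆W s∈S , λ m → proj₂ (∈-select⁻ W∖S? m) s∈S)
      -- `punchIn (c₂ x)` renames the `k` colours of `c₁` to those other than `c₂ x`, and all arcs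
      -- leaving `S` end at `x`.
      return (proj₁ crit (_ , glue-colours {c₁ = punchIn (c₂ x) ∘ c₁}
        (λ z zs cyc inS mono → col₁ z zs cyc inS (All.map (punchIn-injective (c₂ x) _ _) mono))
        (λ v∈ v∉ → ∈-select⁺ W∖S? (v∈ , v∉)) col₂
        λ {u} {v} u∈ v∈ v∉ a e → [ v∉ , (λ { refl → punchInᵢ≢i (c₂ x) (c₁ u) e }) ]′ (exit u∈ v∈ a)))) id
      where
      W∖S? = λ v → v ∈ₛ? W ×-dec ¬? (v ∈ₛ? S)
      W∖S  = select W∖S?

  -- Recolouring v with colour i cannot succeed, so v closes a cycle in every colour class.
  cycle-through : ∀ {k W v} → ¬ Colourable k W → ∀ {c : V D → Fin k} → Colours (W ∖ v) c → ∀ i →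
                  DN (∃ λ xs → DirectedCycle D v xs × All (_∈ₛ W ∖ v) xs × All (λ w → c w ≡ i) xs)
  cycle-through {k} {W} {v} notcol {c} col i fail = notcol (c' , col')
    where
    c' : V D → Fin k
    c' w with w ≟ v
    ... | yes _ = i
    ... | no  _ = c w
    at-v : c' v ≡ i
    at-v with v ≟ v
    ... | yes _ = refl
    ... | no ne = contradiction refl ne
    off-v : ∀ {w} → w ≢ v → c' w ≡ c w
    off-v {w} ne with w ≟ v
    ... | yes e = contradiction e ne
    ... | no  _ = refl
    col' : Colours W c'
    col' x xs cyc inW mono with v ∈? (x ∷ xs)
    ... | no v∉ = col x xs cyc (All.tabulate λ m → ∈-∖⁺ (All.lookup inW m) (ne m))
          (All.tabulate λ m → trans (sym (off-v (ne (there m)))) (trans (All.lookup mono m) (off-v (ne (here refl)))))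
      where
      ne : ∀ {w} → w ∈ x ∷ xs → w ≢ v
      ne m refl = v∉ m
    ... | yes v∈ with ys , (p , uniq) , ys⊆ ← rotate-cycle cyc v∈ =
      fail (ys , (p , uniq) , All.tabulate (λ m → ∈-∖⁺ (All.lookup inW (ys⊆ m)) (ne m)) ,
            All.tabulate (λ m → trans (sym (off-v (ne m))) (trans (same (ys⊆ m)) (trans (sym (same v∈)) at-v))))
      where
      ne : ∀ {w} → w ∈ ys → w ≢ v
      ne m refl = unique-head uniq m
      same : ∀ {w} → w ∈ x ∷ xs → c' w ≡ c' x
      same (here refl) = refl
      same (there m)   = All.lookup mono m

-- Subdivisions from cycles and paths

Unique-++⁻ˡ : {A : Set} (xs : List A) {ys : List A} → Unique (xs ++ ys) → Unique xs
Unique-++⁻ˡ []       u         = []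
Unique-++⁻ˡ (x ∷ xs) (x≢ ∷ u) = All.++⁻ˡ xs x≢ ∷ Unique-++⁻ˡ xs u

module _ {A T : Set} where

  names : List (A × T) → List A
  names = map proj₁

  labelled : T → List A → List (A × T)
  labelled t = map (_, t)

  names-labelled : ∀ t xs → names (labelled t xs) ≡ xs
  names-labelled t xs = trans (sym (map-∘ xs)) (map-id xs)

  label-unique : ∀ {M : List (A × T)} → Unique (names M) → ∀ {x t t'} → (x , t) ∈ M → (x , t') ∈ M → t ≡ t'
  label-unique u       (here refl) (here refl) = refl
  label-unique u       (here refl) (there m')  = contradiction (∈-map⁺ proj₁ m') (unique-head u)
  label-unique u       (there m)   (here refl) = contradiction (∈-map⁺ proj₁ m) (unique-head u)
  label-unique (_ ∷ u) (there m)   (there m')  = label-unique u m m'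

  split-labelled : ∀ t₁ t₂ t₃ xs y zs → List (A × T)
  split-labelled t₁ t₂ t₃ xs y zs = labelled t₁ xs ++ (y , t₂) ∷ labelled t₃ zs

  names-split : ∀ t₁ t₂ t₃ xs y zs → names (split-labelled t₁ t₂ t₃ xs y zs) ≡ xs ++ y ∷ zs
  names-split t₁ t₂ t₃ xs y zs = trans (map-++ proj₁ (labelled t₁ xs) _) (cong₂ (λ l r → l ++ y ∷ r) (names-labelled t₁ xs) (names-labelled t₃ zs))

module _ {H D : Digraph} where

  Label : Set
  Label = V H ⊎ V H × V H

  -- Labelling every used vertex by the branch vertex or the arc it serves reduces all disjointness conditions to one Unique.
  subdivision : (φ : V H → V D) (path : V H → V H → List (V D)) (M : List (V D × Label)) → Unique (names M) →
                (∀ h → (φ h , inj₁ h) ∈ M) →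
                (∀ u v → Arc H u v → ∀ {w} → w ∈ path u v → (w , inj₂ (u , v)) ∈ M) →
                (∀ u v → Arc H u v → Walk D (φ u) (path u v) (φ v)) →
                (∀ u v → Arc H u v → Unique (path u v)) →
                Subdivision H D
  subdivision φ path M uniq branch inner walks uniqs = record
    { φ = φ
    ; φ-inj = λ u v e → inj₁-injective (label-unique uniq (branch u) (subst (λ z → (z , inj₁ v) ∈ M) (sym e) (branch v)))
    ; path = path
    ; path-walk = walks
    ; path-uniq = uniqs
    ; path-avoid = λ { u v a w w∈ h refl → case-⊥ (label-unique uniq (branch h) (inner u v a w∈)) }
    ; path-disj = λ u v u' v' a a' ne w w∈ w∈' →
        ne (pair-injective (inj₂-injective (label-unique uniq (inner u v a w∈) (inner u' v' a' w∈'))))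
    }
    where
    case-⊥ : ∀ {h : V H} {p : V H × V H} → ¬ (inj₁ h ≡ inj₂ p)
    case-⊥ ()
    pair-injective : ∀ {u v u' v' : V H} → (u , v) ≡ (u' , v') → u ≡ u' × v ≡ v'
    pair-injective refl = refl , refl

module _ {D : Digraph} {b' : V D} {A C : List (V D)} (cycA : DirectedCycle D b' A) (cycC : DirectedCycle D b' C)
         {a' c' : V D} (a∈ : a' ∈ A) (c∈ : c' ∈ C) where

  -- Cutting `A` at `a'` and `C` at `c'` yields the four paths that replace the digons. The walk
  -- from `c'` to `a'` must have an inner vertex, which becomes the image of `d`.
  subdivision-H₁ : ∀ {d' R} → Walk D c' (d' ∷ R) a' → Unique (b' ∷ A ++ C ++ d' ∷ R) → Subdivision H₁ D
  subdivision-H₁ {d'} {R} (cd , da) uniq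
    with A₁ , A₂ , refl ← ∈-∃++ a∈ | C₁ , C₂ , refl ← ∈-∃++ c∈
    with ba , ab ← walk-++⁻ D A₁ (proj₁ cycA) | bc , cb ← walk-++⁻ D C₁ (proj₁ cycC) =
    subdivision φ path M (subst Unique (sym M≡) uniq) branch inner walks uniqs
    where
    φ : V H₁ → V D
    φ zero = a'
    φ (suc zero) = b'
    φ (suc (suc zero)) = c'
    φ (suc (suc (suc zero))) = d'
    path : V H₁ → V H₁ → List (V D)
    path zero (suc zero) = A₂
    path (suc zero) zero = A₁
    path (suc zero) (suc (suc zero)) = C₁
    path (suc (suc zero)) (suc zero) = C₂
    path (suc (suc (suc zero))) zero = R
    path _ _ = []
    MA MC MR M : List (V D × Label {H₁} {D})
    MA = split-labelled (inj₂ (b , a)) (inj₁ a) (inj₂ (a , b)) A₁ a' A₂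
    MC = split-labelled (inj₂ (b , c)) (inj₁ c) (inj₂ (c , b)) C₁ c' C₂
    MR = (d' , inj₁ d) ∷ labelled (inj₂ (d , a)) R
    M  = (b' , inj₁ b) ∷ MA ++ MC ++ MR
    M≡ : names M ≡ b' ∷ (A₁ ++ a' ∷ A₂) ++ (C₁ ++ c' ∷ C₂) ++ d' ∷ R
    M≡ = cong (b' ∷_) (trans (map-++ proj₁ MA _) (cong₂ _++_ (names-split _ _ _ A₁ a' A₂)
           (trans (map-++ proj₁ MC _) (cong₂ _++_ (names-split _ _ _ C₁ c' C₂) (cong (d' ∷_) (names-labelled _ R))))))
    inA : ∀ {m} → m ∈ MA → m ∈ M
    inA = there ∘ ∈-++⁺ˡ
    inC : ∀ {m} → m ∈ MC → m ∈ M
    inC = there ∘ ∈-++⁺ʳ MA ∘ ∈-++⁺ˡ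
    inR : ∀ {m} → m ∈ MR → m ∈ M
    inR = there ∘ ∈-++⁺ʳ MA ∘ ∈-++⁺ʳ MC
    branch : ∀ h → (φ h , inj₁ h) ∈ M
    branch zero = inA (∈-insert (labelled _ A₁))
    branch (suc zero) = here refl
    branch (suc (suc zero)) = inC (∈-insert (labelled _ C₁))
    branch (suc (suc (suc zero))) = inR (here refl)
    inner : ∀ u v → Arc H₁ u v → ∀ {w} → w ∈ path u v → (w , inj₂ (u , v)) ∈ M
    inner zero (suc zero) refl m = inA (∈-++⁺ʳ (labelled _ A₁) (there (∈-map⁺ _ m)))
    inner (suc zero) zero refl m = inA (∈-++⁺ˡ (∈-map⁺ _ m))
    inner (suc zero) (suc (suc zero)) refl m = inC (∈-++⁺ˡ (∈-map⁺ _ m))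
    inner (suc (suc zero)) (suc zero) refl m = inC (∈-++⁺ʳ (labelled _ C₁) (there (∈-map⁺ _ m)))
    inner (suc (suc zero)) (suc (suc (suc zero))) refl ()
    inner (suc (suc (suc zero))) zero refl m = inR (there (∈-map⁺ _ m))
    walks : ∀ u v → Arc H₁ u v → Walk D (φ u) (path u v) (φ v)
    walks zero (suc zero) refl = ab
    walks (suc zero) zero refl = ba
    walks (suc zero) (suc (suc zero)) refl = bc
    walks (suc (suc zero)) (suc zero) refl = cb
    walks (suc (suc zero)) (suc (suc (suc zero))) refl = cd
    walks (suc (suc (suc zero))) zero refl = da
    uniqA = Unique-++⁻ʳ (b' ∷ []) (proj₂ cycA)
    uniqC = Unique-++⁻ʳ (b' ∷ []) (proj₂ cycC)
    uniqs : ∀ u v → Arc H₁ u v → Unique (path u v)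
    uniqs zero (suc zero) refl = Unique-++⁻ʳ (a' ∷ []) (Unique-++⁻ʳ A₁ uniqA)
    uniqs (suc zero) zero refl = Unique-++⁻ˡ A₁ uniqA
    uniqs (suc zero) (suc (suc zero)) refl = Unique-++⁻ˡ C₁ uniqC
    uniqs (suc (suc zero)) (suc zero) refl = Unique-++⁻ʳ (c' ∷ []) (Unique-++⁻ʳ C₁ uniqC)
    uniqs (suc (suc zero)) (suc (suc (suc zero))) refl = []
    uniqs (suc (suc (suc zero))) zero refl = Unique-++⁻ʳ (d' ∷ []) (Unique-++⁻ʳ (C₁ ++ c' ∷ C₂) (Unique-++⁻ʳ (b' ∷ A₁ ++ a' ∷ A₂) uniq))

  -- The digons arise as for `H₁`; `P` and `R`, possibly empty, replace the two arcs into `d`.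
  subdivision-H₂ : ∀ {d' P R} → Walk D a' P d' → Walk D c' R d' → Unique (d' ∷ b' ∷ A ++ C ++ P ++ R) → Subdivision H₂ D
  subdivision-H₂ {d'} {P} {R} ad cd uniq
    with A₁ , A₂ , refl ← ∈-∃++ a∈ | C₁ , C₂ , refl ← ∈-∃++ c∈
    with ba , ab ← walk-++⁻ D A₁ (proj₁ cycA) | bc , cb ← walk-++⁻ D C₁ (proj₁ cycC) =
    subdivision φ path M (subst Unique (sym M≡) uniq) branch inner walks uniqs
    where
    φ : V H₂ → V D
    φ zero = a'
    φ (suc zero) = b'
    φ (suc (suc zero)) = c'
    φ (suc (suc (suc zero))) = d'
    path : V H₂ → V H₂ → List (V D)
    path zero (suc zero) = A₂
    path zero (suc (suc (suc zero))) = P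
    path (suc zero) zero = A₁
    path (suc zero) (suc (suc zero)) = C₁
    path (suc (suc zero)) (suc zero) = C₂
    path (suc (suc zero)) (suc (suc (suc zero))) = R
    path _ _ = []
    MA MC MP MR M : List (V D × Label {H₂} {D})
    MA = split-labelled (inj₂ (b , a)) (inj₁ a) (inj₂ (a , b)) A₁ a' A₂
    MC = split-labelled (inj₂ (b , c)) (inj₁ c) (inj₂ (c , b)) C₁ c' C₂
    MP = labelled (inj₂ (a , d)) P
    MR = labelled (inj₂ (c , d)) R
    M  = (d' , inj₁ d) ∷ (b' , inj₁ b) ∷ MA ++ MC ++ MP ++ MR
    M≡ : names M ≡ d' ∷ b' ∷ (A₁ ++ a' ∷ A₂) ++ (C₁ ++ c' ∷ C₂) ++ P ++ R
    M≡ = cong (λ l → d' ∷ b' ∷ l) (trans (map-++ proj₁ MA _) (cong₂ _++_ (names-split _ _ _ A₁ a' A₂)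
           (trans (map-++ proj₁ MC _) (cong₂ _++_ (names-split _ _ _ C₁ c' C₂)
           (trans (map-++ proj₁ MP _) (cong₂ _++_ (names-labelled _ P) (names-labelled _ R)))))))
    inA : ∀ {m} → m ∈ MA → m ∈ M
    inA = there ∘ there ∘ ∈-++⁺ˡ
    inC : ∀ {m} → m ∈ MC → m ∈ M
    inC = there ∘ there ∘ ∈-++⁺ʳ MA ∘ ∈-++⁺ˡ
    branch : ∀ h → (φ h , inj₁ h) ∈ M
    branch zero = inA (∈-insert (labelled _ A₁))
    branch (suc zero) = there (here refl)
    branch (suc (suc zero)) = inC (∈-insert (labelled _ C₁))
    branch (suc (suc (suc zero))) = here refl
    inner : ∀ u v → Arc H₂ u v → ∀ {w} → w ∈ path u v → (w , inj₂ (u , v)) ∈ M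
    inner zero (suc zero) refl m = inA (∈-++⁺ʳ (labelled _ A₁) (there (∈-map⁺ _ m)))
    inner zero (suc (suc (suc zero))) refl m = there (there (∈-++⁺ʳ MA (∈-++⁺ʳ MC (∈-++⁺ˡ (∈-map⁺ _ m)))))
    inner (suc zero) zero refl m = inA (∈-++⁺ˡ (∈-map⁺ _ m))
    inner (suc zero) (suc (suc zero)) refl m = inC (∈-++⁺ˡ (∈-map⁺ _ m))
    inner (suc (suc zero)) (suc zero) refl m = inC (∈-++⁺ʳ (labelled _ C₁) (there (∈-map⁺ _ m)))
    inner (suc (suc zero)) (suc (suc (suc zero))) refl m = there (there (∈-++⁺ʳ MA (∈-++⁺ʳ MC (∈-++⁺ʳ MP (∈-map⁺ _ m)))))
    walks : ∀ u v → Arc H₂ u v → Walk D (φ u) (path u v) (φ v)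
    walks zero (suc zero) refl = ab
    walks zero (suc (suc (suc zero))) refl = ad
    walks (suc zero) zero refl = ba
    walks (suc zero) (suc (suc zero)) refl = bc
    walks (suc (suc zero)) (suc zero) refl = cb
    walks (suc (suc zero)) (suc (suc (suc zero))) refl = cd
    uniqA = Unique-++⁻ʳ (b' ∷ []) (proj₂ cycA)
    uniqC = Unique-++⁻ʳ (b' ∷ []) (proj₂ cycC)
    uniqPR = Unique-++⁻ʳ (C₁ ++ c' ∷ C₂) (Unique-++⁻ʳ (d' ∷ b' ∷ A₁ ++ a' ∷ A₂) uniq)
    uniqs : ∀ u v → Arc H₂ u v → Unique (path u v)
    uniqs zero (suc zero) refl = Unique-++⁻ʳ (a' ∷ []) (Unique-++⁻ʳ A₁ uniqA)
    uniqs zero (suc (suc (suc zero))) refl = Unique-++⁻ˡ P uniqPR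
    uniqs (suc zero) zero refl = Unique-++⁻ˡ A₁ uniqA
    uniqs (suc zero) (suc (suc zero)) refl = Unique-++⁻ˡ C₁ uniqC
    uniqs (suc (suc zero)) (suc zero) refl = Unique-++⁻ʳ (c' ∷ []) (Unique-++⁻ʳ C₁ uniqC)
    uniqs (suc (suc zero)) (suc (suc (suc zero))) refl = Unique-++⁻ʳ P uniqPR

-- Decidability of subdivisions

-- The positions of such a list inject into `Fin n`. This bounds the paths of a subdivision and
-- makes the search for one finite.
unique-length : ∀ {n} {xs : List (Fin n)} → Unique xs → length xs ≤ n
unique-length {xs = xs} u = injective⇒≤ (lookup-injective u)
  where
  lookup-injective : ∀ {A : Set} {xs : List A} → Unique xs → ∀ {i j} → lookup xs i ≡ lookup xs j → i ≡ j
  lookup-injective (_ ∷ _)  {zero}  {zero}  e = refl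
  lookup-injective (x≢ ∷ _) {zero}  {suc j} e = contradiction e (All.lookup x≢ (∈-lookup j))
  lookup-injective (x≢ ∷ _) {suc i} {zero}  e = contradiction (sym e) (All.lookup x≢ (∈-lookup i))
  lookup-injective (_ ∷ u)  {suc i} {suc j} e = cong suc (lookup-injective u e)

-- `Q` cuts the type down to a searchable part, as a length bound does for lists.
Search : {A : Set} → (A → Set) → Set₁
Search {A} Q = {P : A → Set} → Decidable P → Dec (∃ λ x → Q x × P x)

search-Fin : ∀ {n} → Search {Fin n} (λ _ → ⊤)
search-Fin P? = map′ (λ (i , p) → i , tt , p) (λ (i , _ , p) → i , p) (any? P?)

search-List : ∀ {n} m → Search {List (Fin n)} (λ xs → length xs ≤ m)
search-List zero    P? = map′ (λ p → [] , z≤n , p) (λ { ([] , _ , p) → p }) (P? [])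
search-List (suc m) P? = map′
  (λ { (inj₁ p) → [] , z≤n , p ; (inj₂ (x , xs , l , p)) → x ∷ xs , s≤s l , p })
  (λ { ([] , _ , p) → inj₁ p ; (x ∷ xs , s≤s l , p) → inj₂ (x , xs , l , p) })
  (P? [] ⊎-dec any? λ x → search-List m (λ xs → P? (x ∷ xs)))

-- A function rebuilt from its values is only pointwise equal to the original, so `P` has to respect
-- pointwise equality.
search-function : ∀ {k} {A : Set} {Q : A → Set} → Search Q → {P : (Fin k → A) → Set} →
                  (∀ {f g} → (∀ i → f i ≡ g i) → P f → P g) → Decidable P → Dec (∃ λ f → (∀ i → Q (f i)) × P f)
search-function {zero} {A} search {P} ext P? =
  map′ (λ p → nil , (λ ()) , p) (λ (f , _ , p) → ext (λ ()) p) (P? nil)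
  where
  nil : Fin 0 → A
  nil ()
search-function {suc k} {A} search {P} ext P? = map′
  (λ (x , qx , f , qf , p) → cons x f , (λ { zero → qx ; (suc i) → qf i }) , p)
  (λ (f , qf , p) → f zero , qf zero , f ∘ suc , qf ∘ suc , ext (λ { zero → refl ; (suc i) → refl }) p)
  (search λ x → search-function search (λ e → ext λ { zero → refl ; (suc i) → e i }) (P? ∘ cons x))
  where
  cons : ∀ {k} → A → (Fin k → A) → Fin (suc k) → A
  cons x f zero    = x
  cons x f (suc i) = f i

module _ (H D : Digraph) where

  open DecMembership (_≟_ {size D}) using (_∈?_)
  open DecUnique (_≟_ {size D}) using (unique?)

  -- The conditions of `Subdivision`, arranged so that every quantifier ranges over a finite type
  -- and every hypothesis is decidable.
  IsSubdivision : (V H → V D) → (V H → V H → List (V D)) → Set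
  IsSubdivision φ path =
    (∀ u v → φ u ≡ φ v → u ≡ v) ×
    (∀ u v → Arc H u v → Walk D (φ u) (path u v) (φ v) × Unique (path u v) ×
      (∀ w → w ∈ path u v → (∀ h → w ≢ φ h) ×
        (∀ u' v' → Arc H u' v' → ¬ (u ≡ u' × v ≡ v') → w ∉ path u' v')))

  isSubdivision? : ∀ φ path → Dec (IsSubdivision φ path)
  isSubdivision? φ path =
    (all? λ u → all? λ v → φ u ≟ φ v →-dec u ≟ v) ×-dec
    (all? λ u → all? λ v → arc? H u v →-dec walk? D (φ u) (path u v) (φ v) ×-dec unique? (path u v) ×-dec
      (all? λ w → w ∈? path u v →-dec (all? λ h → ¬? (w ≟ φ h)) ×-dec
        (all? λ u' → all? λ v' → arc? H u' v' →-dec ¬? (u ≟ u' ×-dec v ≟ v') →-dec ¬? (w ∈? path u' v'))))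

  isSubdivision-ext : ∀ {φ φ' path path'} → (∀ u → φ u ≡ φ' u) → (∀ u v → Arc H u v → path u v ≡ path' u v) →
                      IsSubdivision φ path → IsSubdivision φ' path'
  isSubdivision-ext {φ} {φ'} {path} {path'} eφ ep (inj , paths) =
    (λ u v e → inj u v (trans (eφ u) (trans e (sym (eφ v))))) ,
    λ u v a → let p , uniq , rest = paths u v a in
      subst (λ xs → Walk D (φ' u) xs (φ' v)) (ep u v a) (subst₂ (λ x y → Walk D x (path u v) y) (eφ u) (eφ v) p) ,
      subst Unique (ep u v a) uniq ,
      λ w m → let avoid , disj = rest w (subst (w ∈_) (sym (ep u v a)) m) in
        (λ h e → avoid h (trans e (sym (eφ h)))) ,
        λ u' v' a' ne m' → disj u' v' a' ne (subst (w ∈_) (sym (ep u' v' a')) m')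

  -- The path system is encoded with a single index, so that one application of `search-function`
  -- runs through all of them.
  pairs : (Fin (size H * size H) → List (V D)) → V H → V H → List (V D)
  pairs p u v = p (combine u v)

  subdivision? : Dec (Subdivision H D)
  subdivision? = map′ to from
    (search-function search-Fin {λ φ → ∃ λ p → (∀ i → length (p i) ≤ size D) × IsSubdivision φ (pairs p)}
      (λ e (p , short , s) → p , short , isSubdivision-ext e (λ _ _ _ → refl) s)
      λ φ → search-function (search-List (size D)) (λ e → isSubdivision-ext (λ _ → refl) (λ u v _ → e (combine u v)))
              λ p → isSubdivision? φ (pairs p))
    where
    to : (∃ λ φ → (∀ _ → ⊤) × ∃ λ p → (∀ i → length (p i) ≤ size D) × IsSubdivision φ (pairs p)) → Subdivision H D
    to (φ , _ , p , _ , inj , paths) = record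
      { φ = φ ; φ-inj = inj ; path = pairs p
      ; path-walk = λ u v a → proj₁ (paths u v a)
      ; path-uniq = λ u v a → proj₁ (proj₂ (paths u v a))
      ; path-avoid = λ u v a w m → proj₁ (proj₂ (proj₂ (paths u v a)) w m)
      ; path-disj = λ u v u' v' a a' ne w m → proj₂ (proj₂ (proj₂ (paths u v a)) w m) u' v' a' ne
      }
    from : Subdivision H D → ∃ λ φ → (∀ _ → ⊤) × ∃ λ p → (∀ i → length (p i) ≤ size D) × IsSubdivision φ (pairs p)
    from s = φ , (λ _ → tt) , p , short ,
      isSubdivision-ext (λ _ → refl) path≡p
        (φ-inj , λ u v a → path-walk u v a , path-uniq u v a , λ w m → path-avoid u v a w m , λ u' v' a' ne → path-disj u v u' v' a a' ne w m)
      where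
      open Subdivision s
      -- Paths of non-arcs are arbitrary, hence possibly too long for the search.
      trim : V H → V H → List (V D)
      trim u v with arc? H u v
      ... | yes _ = path u v
      ... | no  _ = []
      trim-short : ∀ u v → length (trim u v) ≤ size D
      trim-short u v with arc? H u v
      ... | yes a = unique-length (path-uniq u v a)
      ... | no  _ = z≤n
      trim-arc : ∀ u v → Arc H u v → path u v ≡ trim u v
      trim-arc u v a with arc? H u v
      ... | yes _ = refl
      ... | no ¬a = contradiction a ¬a
      p : Fin (size H * size H) → List (V D)
      p i = trim (quotient (size H) i) (remainder {size H} (size H) i)
      short : ∀ i → length (p i) ≤ size D
      short i = trim-short _ _
      path≡p : ∀ u v → Arc H u v → path u v ≡ pairs p u v
      path≡p u v a = trans (trim-arc u v a) (sym (cong (λ (x , y) → trim x y) (remQuot-combine u v)))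

-- Complete digraphs and the lower bound

complete : ℕ → Digraph
complete n = record { size = n ; arc = λ u v → isYes≢ u v ; loopless = irrefl }
  where
  isYes≢ : Fin n → Fin n → Bool
  isYes≢ u v = does (¬? (u ≟ v))
  irrefl : ∀ v → isYes≢ v v ≡ false
  irrefl v with v ≟ v
  ... | yes _ = refl
  ... | no ne = contradiction refl ne

complete-arc : ∀ {n} {u v : Fin n} → u ≢ v → Arc (complete n) u v
complete-arc {u = u} {v} ne with u ≟ v
... | yes e = contradiction e ne
... | no _  = refl

-- With all colours distinct, a monochromatic cycle would be a loop. With fewer colours, two
-- vertices of the same colour form a digon.
complete-dichromatic : ∀ n → IsDichromaticNumber (complete n) n
complete-dichromatic n = (id , rainbow) , fewer
  where
  rainbow : IsAcyclicColoring (complete n) n id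
  rainbow x xs (p , u) mono with refl ← unique-constant u mono = arc-irrefl (complete n) {x} p
  fewer : ∀ j → j < n → ¬ AcyclicColorable (complete n) j
  fewer j j<n (c , col) with x , y , x<y , e ← pigeonhole j<n c =
    col x (y ∷ []) ((complete-arc x≢y , complete-arc (x≢y ∘ sym)) , ((x≢y ∷ []) ∷ [] ∷ [])) (sym e ∷ [])
    where
    x≢y : x ≢ y
    x≢y refl = <-irrefl refl x<y

-- The branch vertices are distinct vertices of the complete digraph on `m` vertices.
mader-size : ∀ H m → MaderProperty H m → size H ≤ m
mader-size H m mader = injective⇒≤ {f = φ} (φ-inj _ _)
  where open Subdivision (mader (complete m) m (complete-dichromatic m) ≤-refl)
          

-- Low-high orders

module _ {n : ℕ} (x : Fin n) where

  -- A trap is a nonempty set whose arcs lead to a single outside vertex other than x. By Menger's theorem, the absence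
  -- of traps in T says that every vertex of T has two paths to x sharing only their ends.
  record Trap (R : Fin n → Fin n → Set) (T : Subset n) : Set where
    constructor trap
    field
      {Y}   : Subset n
      {q}   : Fin n
      {y}   : Fin n
      Y⊆T   : Y ⊆ₛ T
      y∈Y   : y ∈ₛ Y
      q≢x   : q ≢ x
      exits : ∀ {u w} → u ∈ₛ Y → R u w → w ∈ₛ Y ⊎ w ≡ q

  trap-antitone : ∀ {R R' : Fin n → Fin n → Set} {T} → (∀ {u} → u ∈ₛ T → ∀ {w} → R u w → R' u w) → Trap R' T → Trap R T
  trap-antitone R⊆R' (trap Y⊆T y∈Y q≢x exits) = trap Y⊆T y∈Y q≢x (λ u∈ r → exits u∈ (R⊆R' (Y⊆T u∈) r))

  -- Reduction to two out-arcs at each vertex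

  module Thinning {T : Subset n} (x∉T : x ∉ₛ T) where

    Out : (Fin n → List (Fin n)) → Fin n → Fin n → Set
    Out N u w = w ∈ N u

    infix 6 _[_↦_]
    _[_↦_] : (Fin n → List (Fin n)) → Fin n → List (Fin n) → Fin n → List (Fin n)
    (N [ v ↦ L ]) u with u ≟ v
    ... | yes _ = L
    ... | no  _ = N u

    updated : ∀ {N} v {L} → (N [ v ↦ L ]) v ≡ L
    updated v with v ≟ v
    ... | yes _ = refl
    ... | no ne = contradiction refl ne

    not-updated : ∀ {N v L u} → u ≢ v → (N [ v ↦ L ]) u ≡ N u
    not-updated {v = v} {u = u} ne with u ≟ v
    ... | yes e = contradiction e ne
    ... | no _  = refl

    module _ {N : Fin n → List (Fin n)} {v : Fin n} {L : List (Fin n)} (fan : ¬ Trap (Out (N [ v ↦ L ])) T) where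

      -- The shape of a trap that arises when the arc from `v` to `u` is deleted: that arc is its
      -- only escape.
      record Obstruction (u : Fin n) (L' : List (Fin n)) : Set where
        field
          Y     : Subset n
          q     : Fin n
          Y⊆T   : Y ⊆ₛ T
          q≢x   : q ≢ x
          v∈Y   : v ∈ₛ Y
          u∉Y   : u ∉ₛ Y
          u≢q   : u ≢ q
          at-v  : ∀ {w} → w ∈ L' → w ∈ₛ Y ⊎ w ≡ q
          off-v : ∀ {a w} → a ∈ₛ Y → a ≢ v → w ∈ N a → w ∈ₛ Y ⊎ w ≡ q

      obstruction : ∀ {u L'} → (∀ {w} → w ∈ L → w ≡ u ⊎ w ∈ L') → Trap (Out (N [ v ↦ L' ])) T → Obstruction u L'
      obstruction {u} {L'} split t@(trap {Y} {q} Y⊆T y∈Y q≢x exits) = record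
        { Y = Y ; q = q ; Y⊆T = Y⊆T ; q≢x = q≢x ; v∈Y = v∈Y
        ; u∉Y = λ u∈ → reinstate (λ _ → inj₁ u∈) ; u≢q = λ e → reinstate (λ _ → inj₂ e)
        ; at-v = at-v v∈Y ; off-v = off-v }
        where
        at-v : v ∈ₛ Y → ∀ {w} → w ∈ L' → w ∈ₛ Y ⊎ w ≡ q
        at-v v∈ m = exits v∈ (subst (_ ∈_) (sym (updated {N} v)) m)
        off-v : ∀ {a w} → a ∈ₛ Y → a ≢ v → w ∈ N a → w ∈ₛ Y ⊎ w ≡ q
        off-v a∈ ne m = exits a∈ (subst (_ ∈_) (sym (not-updated {N} ne)) m)
        -- If putting the arc to `u` back did not let `v` escape, `Y` would already be a trap for
        -- `L`.
        reinstate : ¬ (v ∈ₛ Y → u ∈ₛ Y ⊎ u ≡ q)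
        reinstate ok = fan (trap Y⊆T y∈Y q≢x closed)
          where
          closed : ∀ {a w} → a ∈ₛ Y → w ∈ (N [ v ↦ L ]) a → w ∈ₛ Y ⊎ w ≡ q
          closed {a} a∈ m with a ≟ v
          ... | no ne    = off-v a∈ ne m
          ... | yes refl with split m
          ...   | inj₁ refl = ok a∈
          ...   | inj₂ m'   = at-v a∈ m'
        v∈Y : v ∈ₛ Y
        v∈Y with v ∈ₛ? Y
        ... | yes v∈ = v∈
        ... | no v∉  = contradiction (λ v∈ → contradiction v∈ v∉) reinstate

      module _ {u₁ u₂ L₁ L₂} (split : ∀ {w} → w ∈ L → w ≡ u₁ ⊎ w ∈ L₁) (u₁∈L₂ : u₁ ∈ L₂)
               (o₁ : Obstruction u₁ L₁) (o₂ : Obstruction u₂ L₂) where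
        private
          module O₁ = Obstruction o₁
          module O₂ = Obstruction o₂

        -- The two obstructions miss different arcs at `v`, so between them they control all of `L`,
        -- and the union is left only towards `O₁.q` and `O₂.q`. It would be a trap if these two
        -- gave it at most one exit, other than `x`.
        union-escapes : ∀ {q} → q ≢ x → O₁.q ∈ₛ O₁.Y ∪ O₂.Y ⊎ O₁.q ≡ q → ¬ (O₂.q ∈ₛ O₁.Y ∪ O₂.Y ⊎ O₂.q ≡ q)
        union-escapes {q} q≢x in₁ in₂ = fan (trap
          (λ m → [ O₁.Y⊆T , O₂.Y⊆T ]′ (x∈p∪q⁻ O₁.Y O₂.Y m)) (x∈p∪q⁺ (inj₁ O₁.v∈Y)) q≢x closed)
          where
          from₁ : ∀ {w} → w ∈ₛ O₁.Y ⊎ w ≡ O₁.q → w ∈ₛ O₁.Y ∪ O₂.Y ⊎ w ≡ q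
          from₁ (inj₁ m)    = inj₁ (x∈p∪q⁺ (inj₁ m))
          from₁ (inj₂ refl) = in₁
          from₂ : ∀ {w} → w ∈ₛ O₂.Y ⊎ w ≡ O₂.q → w ∈ₛ O₁.Y ∪ O₂.Y ⊎ w ≡ q
          from₂ (inj₁ m)    = inj₁ (x∈p∪q⁺ {p = O₁.Y} (inj₂ m))
          from₂ (inj₂ refl) = in₂
          closed : ∀ {a w} → a ∈ₛ O₁.Y ∪ O₂.Y → w ∈ (N [ v ↦ L ]) a → w ∈ₛ O₁.Y ∪ O₂.Y ⊎ w ≡ q
          closed {a} a∈ m with a ≟ v
          ... | yes refl = [ (λ { refl → from₂ (O₂.at-v u₁∈L₂) }) , from₁ ∘ O₁.at-v ]′ (split m)
          ... | no ne    = [ (λ a∈₁ → from₁ (O₁.off-v a∈₁ ne m)) , (λ a∈₂ → from₂ (O₂.off-v a∈₂ ne m)) ]′ (x∈p∪q⁻ O₁.Y O₂.Y a∈)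

        q₁≢q₂ : O₁.q ≢ O₂.q
        q₁≢q₂ e = union-escapes O₁.q≢x (inj₂ refl) (inj₂ (sym e))

        q₁∉Y₂ : O₁.q ∉ₛ O₂.Y
        q₁∉Y₂ m = union-escapes O₂.q≢x (inj₁ (x∈p∪q⁺ {p = O₁.Y} (inj₂ m))) (inj₂ refl)

        q₂∉Y₁ : O₂.q ∉ₛ O₁.Y
        q₂∉Y₁ m = union-escapes O₁.q≢x (inj₂ refl) (inj₁ (x∈p∪q⁺ (inj₁ m)))

        -- By the three preceding exclusions, the exit of either obstruction is neither in the other
        -- set nor the other exit.
        meet : ∀ {w} → w ∈ₛ O₁.Y ⊎ w ≡ O₁.q → w ∈ₛ O₂.Y ⊎ w ≡ O₂.q → w ∈ₛ O₁.Y ∩ O₂.Y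
        meet (inj₁ m)    (inj₁ m')   = x∈p∩q⁺ (m , m')
        meet (inj₁ m)    (inj₂ refl) = contradiction m q₂∉Y₁
        meet (inj₂ refl) (inj₁ m')   = contradiction m' q₁∉Y₂
        meet (inj₂ refl) (inj₂ e)    = contradiction e q₁≢q₂

      -- (Y₁ ∩ Y₂) ∪ Y₃ is left only towards q₃.
      no-three-obstructions : ∀ {u₁ u₂ u₃ L'} → L ≡ u₁ ∷ u₂ ∷ u₃ ∷ L' →
        Obstruction u₁ (u₂ ∷ u₃ ∷ L') → Obstruction u₂ (u₁ ∷ u₃ ∷ L') → ¬ Obstruction u₃ (u₁ ∷ u₂ ∷ L')
      no-three-obstructions {u₁} {u₂} {u₃} {L'} refl o₁ o₂ o₃ = fan (trap
        (λ m → [ O₁.Y⊆T ∘ proj₁ ∘ x∈p∩q⁻ O₁.Y O₂.Y , O₃.Y⊆T ]′ (x∈p∪q⁻ (O₁.Y ∩ O₂.Y) O₃.Y m))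
        (x∈p∪q⁺ {p = O₁.Y ∩ O₂.Y} (inj₂ O₃.v∈Y)) O₃.q≢x closed)
        where
        module O₁ = Obstruction o₁
        module O₂ = Obstruction o₂
        module O₃ = Obstruction o₃
        meet₁₂ : ∀ {w} → w ∈ₛ O₁.Y ⊎ w ≡ O₁.q → w ∈ₛ O₂.Y ⊎ w ≡ O₂.q → w ∈ₛ O₁.Y ∩ O₂.Y
        meet₁₂ = meet (λ { (here e) → inj₁ e ; (there m) → inj₂ m }) (here refl) o₁ o₂
        left : ∀ {w} → w ∈ₛ O₁.Y ∩ O₂.Y → w ∈ₛ (O₁.Y ∩ O₂.Y) ∪ O₃.Y ⊎ w ≡ O₃.q
        left m = inj₁ (x∈p∪q⁺ (inj₁ m))
        right : ∀ {w} → w ∈ₛ O₃.Y ⊎ w ≡ O₃.q → w ∈ₛ (O₁.Y ∩ O₂.Y) ∪ O₃.Y ⊎ w ≡ O₃.q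
        right (inj₁ m) = inj₁ (x∈p∪q⁺ {p = O₁.Y ∩ O₂.Y} (inj₂ m))
        right (inj₂ e) = inj₂ e
        closed : ∀ {a w} → a ∈ₛ (O₁.Y ∩ O₂.Y) ∪ O₃.Y → w ∈ (N [ v ↦ L ]) a → w ∈ₛ (O₁.Y ∩ O₂.Y) ∪ O₃.Y ⊎ w ≡ O₃.q
        closed {a} a∈ m with a ≟ v
        closed {a} a∈ (here refl)                 | yes refl = right (O₃.at-v (here refl))
        closed {a} a∈ (there (here refl))         | yes refl = right (O₃.at-v (there (here refl)))
        -- This is the arc missing from `o₃`; both `o₁` and `o₂` retain it, so it ends in the
        -- intersection.
        closed {a} a∈ (there (there (here refl))) | yes refl = left (meet₁₂ (O₁.at-v (there (here refl))) (O₂.at-v (there (here refl))))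
        closed {a} a∈ (there (there (there m)))   | yes refl = right (O₃.at-v (there (there m)))
        closed {a} a∈ m | no ne with x∈p∪q⁻ (O₁.Y ∩ O₂.Y) O₃.Y a∈
        ... | inj₂ a∈₃  = right (O₃.off-v a∈₃ ne m)
        ... | inj₁ a∈₁₂ with a∈₁ , a∈₂ ← x∈p∩q⁻ O₁.Y O₂.Y a∈₁₂ = left (meet₁₂ (O₁.off-v a∈₁ ne m) (O₂.off-v a∈₂ ne m))

    -- By `no-three-obstructions`, one of any three out-arcs of `v` can be deleted without creating
    -- a trap. This is repeated until two are left.
    thin-list : ∀ {N v} u₁ u₂ L → ¬ Trap (Out (N [ v ↦ u₁ ∷ u₂ ∷ L ])) T →
                DN (∃₂ λ w₁ w₂ → w₁ ∈ u₁ ∷ u₂ ∷ L × w₂ ∈ u₁ ∷ u₂ ∷ L × ¬ Trap (Out (N [ v ↦ w₁ ∷ w₂ ∷ [] ])) T)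
    thin-list u₁ u₂ [] fan = return (u₁ , u₂ , here refl , there (here refl) , fan)
    thin-list {N} {v} u₁ u₂ (u₃ ∷ L) fan = do
      yes t₃ ← em {Trap (Out (N [ v ↦ u₁ ∷ u₂ ∷ L ])) T}
        where no fan' → do
                w₁ , w₂ , m₁ , m₂ , fan″ ← thin-list {N} {v} u₁ u₂ L fan'
                return (w₁ , w₂ , drop₃ m₁ , drop₃ m₂ , fan″)
      yes t₂ ← em {Trap (Out (N [ v ↦ u₁ ∷ u₃ ∷ L ])) T}
        where no fan' → do
                w₁ , w₂ , m₁ , m₂ , fan″ ← thin-list {N} {v} u₁ u₃ L fan'
                return (w₁ , w₂ , drop₂ m₁ , drop₂ m₂ , fan″)
      yes t₁ ← em {Trap (Out (N [ v ↦ u₂ ∷ u₃ ∷ L ])) T}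
        where no fan' → do
                w₁ , w₂ , m₁ , m₂ , fan″ ← thin-list {N} {v} u₂ u₃ L fan'
                return (w₁ , w₂ , there m₁ , there m₂ , fan″)
      contradiction
        (obstruction fan (λ { (here e) → inj₂ (here e) ; (there (here e)) → inj₂ (there (here e)) ; (there (there (here e))) → inj₁ e ; (there (there (there m))) → inj₂ (there (there m)) }) t₃)
        (no-three-obstructions fan refl
          (obstruction fan (λ { (here e) → inj₁ e ; (there m) → inj₂ m }) t₁)
          (obstruction fan (λ { (here e) → inj₂ (here e) ; (there (here e)) → inj₁ e ; (there (there m)) → inj₂ (there m) }) t₂))
      where
      drop₃ : ∀ {w} → w ∈ u₁ ∷ u₂ ∷ L → w ∈ u₁ ∷ u₂ ∷ u₃ ∷ L
      drop₃ (here e)          = here e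
      drop₃ (there (here e))  = there (here e)
      drop₃ (there (there m)) = there (there (there m))
      drop₂ : ∀ {w} → w ∈ u₁ ∷ u₃ ∷ L → w ∈ u₁ ∷ u₂ ∷ u₃ ∷ L
      drop₂ (here e)  = here e
      drop₂ (there m) = there (there m)

    Pair : (Fin n → List (Fin n)) → (Fin n → List (Fin n)) → Fin n → Set
    Pair N N' v = v ∈ₛ T → ∃₂ λ w₁ w₂ → N' v ≡ w₁ ∷ w₂ ∷ []

    out-nonempty : ∀ {N v} → ¬ Trap (Out N) T → v ∈ₛ T → N v ≢ []
    -- A vertex without arcs is a trap on its own; any `q ≢ x` serves as the exit, and `v` is one.
    out-nonempty {N} {v} fan v∈T e = fan (trap {Y = ⁅ v ⁆} {q = v}
      (λ m → subst (_∈ₛ T) (sym (x∈⁅y⁆⇒x≡y v m)) v∈T) (x∈⁅x⁆ v) (λ { refl → x∉T v∈T })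
      λ u∈ m → contradiction (subst (_ ∈_) (trans (cong N (x∈⁅y⁆⇒x≡y v u∈)) e) m) λ ())

    thin-vertex : ∀ N v → ¬ Trap (Out N) T → v ∈ₛ T →
                  DN (∃₂ λ w₁ w₂ → w₁ ∈ N v × w₂ ∈ N v × ¬ Trap (Out (N [ v ↦ w₁ ∷ w₂ ∷ [] ])) T)
    thin-vertex N v fan v∈T with N v in eq
    ... | []           = contradiction eq (out-nonempty fan v∈T)
    -- Here `u` can only be `x`, since otherwise `v` alone would be a trap. The arc is doubled to
    -- make two.
    ... | u ∷ []       = return (u , u , here refl , here refl , λ t → fan (trap-antitone (λ _ → sub) t))
      where
      sub : ∀ {a w} → w ∈ N a → w ∈ (N [ v ↦ u ∷ u ∷ [] ]) a
      sub {a} m with a ≟ v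
      ... | no _     = m
      ... | yes refl = there (subst (_ ∈_) eq m)
    ... | u₁ ∷ u₂ ∷ L = thin-list {N} {v} u₁ u₂ L λ t → fan (trap-antitone (λ _ → sub) t)
      where
      sub : ∀ {a w} → w ∈ N a → w ∈ (N [ v ↦ u₁ ∷ u₂ ∷ L ]) a
      sub {a} m with a ≟ v
      ... | no _     = m
      ... | yes refl = subst (_ ∈_) eq m

    thin-all : ∀ N → ¬ Trap (Out N) T → ∀ vs →
               DN (∃ λ N' → (∀ v → v ∈ vs → Pair N N' v) × (∀ v w → w ∈ N' v → w ∈ N v) × ¬ Trap (Out N') T)
    thin-all N fan []       = return (N , (λ _ ()) , (λ _ _ → id) , fan)
    thin-all N fan (v ∷ vs) = do
      N' , pairs , sub , fan' ← thin-all N fan vs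
      yes v∈T ← em {v ∈ₛ T}
        where no v∉T → return (N' , (λ { _ (here refl) v∈T → contradiction v∈T v∉T ; u (there m) → pairs u m }) , sub , fan')
      w₁ , w₂ , m₁ , m₂ , fan″ ← thin-vertex N' v fan' v∈T
      let N″ = N' [ v ↦ w₁ ∷ w₂ ∷ [] ]
      return (N″ , (λ u m u∈T → case-pair u m u∈T w₁ w₂ N' pairs) , (λ u _ m → case-sub u m m₁ m₂ sub) , fan″)
      where
      case-pair : ∀ u → u ∈ v ∷ vs → u ∈ₛ T → ∀ w₁ w₂ N' → (∀ v → v ∈ vs → Pair N N' v) →
                  ∃₂ λ z₁ z₂ → (N' [ v ↦ w₁ ∷ w₂ ∷ [] ]) u ≡ z₁ ∷ z₂ ∷ []
      case-pair u m u∈T w₁ w₂ N' pairs with u ≟ v | m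
      ... | yes _ | _        = w₁ , w₂ , refl
      ... | no ne | here e   = contradiction e ne
      ... | no ne | there m' = pairs u m' u∈T
      case-sub : ∀ u {w w₁ w₂ N'} → w ∈ (N' [ v ↦ w₁ ∷ w₂ ∷ [] ]) u → w₁ ∈ N' v → w₂ ∈ N' v →
                 (∀ v w → w ∈ N' v → w ∈ N v) → w ∈ N u
      case-sub u m m₁ m₂ sub with u ≟ v | m
      ... | no _     | m'                = sub u _ m'
      ... | yes refl | here refl         = sub u _ m₁
      ... | yes refl | there (here refl) = sub u _ m₂

  Step : (Fin n → Fin 2 → Fin n) → Fin n → Fin n → Set
  Step g u w = ∃ λ i → w ≡ g u i

  -- Out-degree exactly two, counting parallel arcs, is what the arc count in `¬all-TwoIn` and the
  -- contractions below rely on.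
  two-arcs : ∀ {T} → x ∉ₛ T → ∀ N → ¬ Trap (λ u w → w ∈ N u) T →
             DN (∃ λ g → (∀ v → v ∈ₛ T → ∀ i → g v i ∈ N v) × ¬ Trap (Step g) T)
  two-arcs {T} x∉T N fan = do
    N' , pairs , sub , fan' ← Thinning.thin-all x∉T N fan (allFin n)
    return (pick N' , (λ _ v∈T i → sub _ _ (pick-∈ N' (pairs _ (∈-allFin _)) v∈T i)) ,
            λ t → fan' (trap-antitone (λ v∈T → pick-all N' (pairs _ (∈-allFin _)) v∈T) t))
    where
    pick : (Fin n → List (Fin n)) → Fin n → Fin 2 → Fin n
    pick N' v with N' v
    ... | w₁ ∷ w₂ ∷ _ = λ { zero → w₁ ; (suc _) → w₂ }
    -- A default for vertices outside `T`, about which nothing is claimed.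
    ... | _           = λ _ → v
    pick-∈ : ∀ N' {v} → (v ∈ₛ T → ∃₂ λ w₁ w₂ → N' v ≡ w₁ ∷ w₂ ∷ []) → v ∈ₛ T → ∀ i → pick N' v i ∈ N' v
    pick-∈ N' {v} pair v∈T i with N' v | pair v∈T | i
    ... | _ | w₁ , w₂ , refl | zero  = here refl
    ... | _ | w₁ , w₂ , refl | suc _ = there (here refl)
    pick-all : ∀ N' {v} → (v ∈ₛ T → ∃₂ λ w₁ w₂ → N' v ≡ w₁ ∷ w₂ ∷ []) → v ∈ₛ T → ∀ {w} → w ∈ N' v → Step (pick N') v w
    pick-all N' {v} pair v∈T m with N' v | pair v∈T | m
    ... | _ | w₁ , w₂ , refl | here e         = zero , e
    ... | _ | w₁ , w₂ , refl | there (here e) = suc zero , e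

-- Existence of low-high orders by contraction

module _ {n : ℕ} (x : Fin n) where

  redirect : Fin n → Fin n → Fin n → Fin n
  redirect v u w with w ≟ v
  ... | yes _ = u
  ... | no  _ = w

  redirect-at : ∀ v u {w} → w ≡ v → redirect v u w ≡ u
  redirect-at v u {w} e with w ≟ v
  ... | yes _ = refl
  ... | no ne = contradiction e ne

  redirect-off : ∀ {v} u {w} → w ≢ v → redirect v u w ≡ w
  redirect-off {v} u {w} ne with w ≟ v
  ... | yes e = contradiction e ne
  ... | no _  = refl

  Towards : (ℕ → ℕ → Set) → (Fin n → Fin 2 → Fin n) → Subset n → (Fin n → ℕ) → Fin n → Set
  Towards _≺_ g T r v = ∃ λ i → g v i ≡ x ⊎ (g v i ∈ₛ T × r (g v i) ≺ r v)

  -- A low-high order in the sense of Georgiadis and Tarjan, with x both below and above all of T.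
  record LowHigh (g : Fin n → Fin 2 → Fin n) (T : Subset n) (r : Fin n → ℕ) : Set where
    field
      injective : ∀ {u v} → u ∈ₛ T → v ∈ₛ T → r u ≡ r v → u ≡ v
      low       : ∀ {v} → v ∈ₛ T → Towards _<_ g T r v
      high      : ∀ {v} → v ∈ₛ T → Towards _>_ g T r v

  module _ {g : Fin n → Fin 2 → Fin n} {T : Subset n} (x∉T : x ∉ₛ T) (fan : ¬ Trap x (Step x g) T)
           (into : ∀ {v} → v ∈ₛ T → ∀ i → g v i ∈ₛ T ⊎ g v i ≡ x) where

    In : Fin n → Fin n × Fin 2 → Set
    In v (y , i) = y ∈ₛ T × g y i ≡ v

    AtMostOneIn : Fin n → Set
    AtMostOneIn v = ∀ {e e'} → In v e → In v e' → e ≡ e'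

    TwoIn : Fin n → Set
    TwoIn v = ∃₂ λ e e' → In v e × In v e' × e ≢ e'

    -- There are 2|T| arcs and one of them enters x, so not all vertices of T are entered twice.
    ¬all-TwoIn : ∀ {s j} → s ∈ₛ T → g s j ≡ x → ¬ (∀ v → v ∈ₛ T → TwoIn v)
    ¬all-TwoIn {s} {j} s∈T to-x two = <-irrefl refl (injective⇒≤ {f = f} f-injective)
      where
      -- Vertices outside `T` are assigned their own two slots, so that the count can be made in all
      -- of `Fin n × Fin 2`.
      arc-into : Fin n → Fin 2 → Fin n × Fin 2
      arc-into v i with v ∈ₛ? T | i
      ... | no _    | _     = v , i
      ... | yes v∈T | zero  = proj₁ (two v v∈T)
      ... | yes v∈T | suc _ = proj₁ (proj₂ (two v v∈T))
      arc-into-∈ : ∀ {v} i → v ∈ₛ T → In v (arc-into v i)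
      arc-into-∈ {v} i v∈T with v ∈ₛ? T | i
      ... | no v∉T   | _     = contradiction v∈T v∉T
      ... | yes v∈T' | zero  = proj₁ (proj₂ (proj₂ (two v v∈T')))
      ... | yes v∈T' | suc _ = proj₁ (proj₂ (proj₂ (proj₂ (two v v∈T'))))
      arc-into-∉ : ∀ {v} i → v ∉ₛ T → arc-into v i ≡ (v , i)
      arc-into-∉ {v} i v∉T with v ∈ₛ? T | i
      ... | no _    | _ = refl
      ... | yes v∈T | _ = contradiction v∈T v∉T
      arc-into-distinct : ∀ {v} i i' → v ∈ₛ T → arc-into v i ≡ arc-into v i' → i ≡ i'
      arc-into-distinct {v} i i' v∈T e with v ∈ₛ? T | i | i'
      ... | no v∉T  | _ | _ = contradiction v∈T v∉T
      ... | yes _   | zero     | zero     = refl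
      ... | yes v∈' | zero     | suc zero = contradiction e (proj₂ (proj₂ (proj₂ (proj₂ (two v v∈')))))
      ... | yes v∈' | suc zero | zero     = contradiction (sym e) (proj₂ (proj₂ (proj₂ (proj₂ (two v v∈')))))
      ... | yes _   | suc zero | suc zero = refl
      In-source : ∀ {v e e'} → e ≡ e' → In v e → proj₁ e' ∈ₛ T
      In-source refl (y∈T , _) = y∈T
      In-unique : ∀ {v v' e e'} → e ≡ e' → In v e → In v' e' → v ≡ v'
      In-unique refl (_ , e) (_ , e') = trans (sym e) e'
      arc-into-injective : ∀ {v i v' i'} → arc-into v i ≡ arc-into v' i' → (v , i) ≡ (v' , i')
      arc-into-injective {v} {i} {v'} {i'} e = by-cases (v ∈ₛ? T) (v' ∈ₛ? T)
        where
        by-cases : Dec (v ∈ₛ T) → Dec (v' ∈ₛ T) → (v , i) ≡ (v' , i')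
        by-cases (yes v∈) (yes v'∈) with refl ← In-unique e (arc-into-∈ i v∈) (arc-into-∈ i' v'∈) = cong (v ,_) (arc-into-distinct i i' v∈ e)
        by-cases (yes v∈) (no v'∉)  = contradiction (In-source (trans e (arc-into-∉ i' v'∉)) (arc-into-∈ i v∈)) v'∉
        by-cases (no v∉)  (yes v'∈) = contradiction (In-source (trans (sym e) (arc-into-∉ i v∉)) (arc-into-∈ i' v'∈)) v∉
        by-cases (no v∉)  (no v'∉)  = trans (sym (arc-into-∉ i v∉)) (trans e (arc-into-∉ i' v'∉))
      arc-into≢ : ∀ {v} i → arc-into v i ≢ (s , j)
      arc-into≢ {v} i e = v∉ (subst (_∈ₛ T) (sym (cong proj₁ (trans (sym (arc-into-∉ i v∉)) e))) s∈T)
        where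
        v∉ : v ∉ₛ T
        v∉ v∈ = x∉T (subst (_∈ₛ T) (In-unique e (arc-into-∈ i v∈) (s∈T , to-x)) v∈)
      code : Fin n × Fin 2 → Fin (n * 2)
      code (y , i) = combine y i
      code-injective : ∀ {e e'} → code e ≡ code e' → e ≡ e'
      code-injective {y , i} {y' , i'} eq with combine-injective y i y' i' eq
      ... | refl , refl = refl
      decode : Fin (n * 2) → Fin n × Fin 2
      decode k = quotient {n} 2 k , remainder {n} 2 k
      f : Fin (suc (n * 2)) → Fin (n * 2)
      -- The additional index is sent to the arc entering `x`, which no other index hits.
      f zero    = code (s , j)
      f (suc k) = code (arc-into (proj₁ (decode k)) (proj₂ (decode k)))
      f-injective : ∀ {k l} → f k ≡ f l → k ≡ l
      f-injective {zero}  {zero}  _ = refl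
      f-injective {zero}  {suc l} e = contradiction (sym (code-injective e)) (arc-into≢ {proj₁ (decode l)} (proj₂ (decode l)))
      f-injective {suc k} {zero}  e = contradiction (code-injective e) (arc-into≢ {proj₁ (decode k)} (proj₂ (decode k)))
      f-injective {suc k} {suc l} e = cong suc (trans (sym (combine-remQuot {n} 2 k))
        (trans (cong code decode-eq) (combine-remQuot {n} 2 l)))
        where
        decode-eq : decode k ≡ decode l
        decode-eq = arc-into-injective (code-injective {arc-into (proj₁ (decode k)) (proj₂ (decode k))} {arc-into (proj₁ (decode l)) (proj₂ (decode l))} e)

    exists-AtMostOneIn : ∀ {v} → v ∈ₛ T → DN (∃ λ v → v ∈ₛ T × AtMostOneIn v)
    exists-AtMostOneIn {v₀} v₀∈T = do
      no none ← em {∃ λ v → v ∈ₛ T × AtMostOneIn v}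
        where yes some → return some
      yes (s , j , s∈T , to-x) ← em {∃₂ λ s j → s ∈ₛ T × g s j ≡ x}
        -- Without an arc to `x` all of `T` would be a trap, with any `q ≢ x`.
        where no ¬exit → contradiction
                (trap {Y = T} {q = v₀} (λ m → m) v₀∈T (λ { refl → x∉T v₀∈T })
                  λ { u∈T (i , refl) → [ inj₁ , (λ e → contradiction (_ , i , u∈T , e) ¬exit) ]′ (into u∈T i) }) fan
      two ← DN-∀ (λ v → TwoIn-or-∉ (λ once v∈T → none (v , v∈T , once)))
      contradiction two (¬all-TwoIn s∈T to-x)
      where
      TwoIn-or-∉ : ∀ {v} → (AtMostOneIn v → ¬ v ∈ₛ T) → DN (v ∈ₛ T → TwoIn v)
      TwoIn-or-∉ {v} f = do
        yes v∈T ← em {v ∈ₛ T}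
          where no v∉T → return (λ v∈T → contradiction v∈T v∉T)
        no ¬two ← em {TwoIn v}
          where yes two → return (λ _ → two)
        contradiction v∈T (f (once ¬two))
        where
        once : ¬ TwoIn v → AtMostOneIn v
        once ¬two {y , i} {y' , i'} in₁ in₂ with y ≟ y' | i ≟ i'
        ... | yes refl | yes refl = refl
        ... | no ne    | _        = contradiction (_ , _ , in₁ , in₂ , ne ∘ cong proj₁) ¬two
        ... | _        | no ne    = contradiction (_ , _ , in₁ , in₂ , ne ∘ cong proj₂) ¬two

    module _ {v : Fin n} (v∈T : v ∈ₛ T) where

      v≢x : v ≢ x
      v≢x refl = x∉T v∈T

      -- Contraction of an arc from `v` to `u`: what entered `v` now enters `u`, and every remaining
      -- vertex keeps two out-arcs.
      contract : Fin n → Fin n → Fin 2 → Fin n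
      contract u y i = redirect v u (g y i)

      T' : Subset n
      T' = T ∖ v

      T'⊆T : ∀ {u} → u ∈ₛ T' → u ∈ₛ T
      T'⊆T = proj₁ ∘ ∈-∖⁻

      contract-into : ∀ {u} → u ∈ₛ T' ⊎ u ≡ x → ∀ {y} → y ∈ₛ T' → ∀ i → contract u y i ∈ₛ T' ⊎ contract u y i ≡ x
      contract-into {u} u-ok {y} y∈ i with g y i ≟ v
      ... | yes _ = u-ok
      ... | no ne = [ (λ m → inj₁ (∈-∖⁺ m ne)) , inj₂ ]′ (into (T'⊆T y∈) i)

      -- Otherwise `v` alone would be a trap. When no arc of `v` goes to `x`, this excludes loops
      -- and parallel arcs at `v`.
      two-exits : ∀ {q} → q ≢ x → ¬ (∀ i → g v i ≡ v ⊎ g v i ≡ q)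
      two-exits {q} q≢x f = fan (trap {Y = ⁅ v ⁆} (λ m → subst (_∈ₛ T) (sym (x∈⁅y⁆⇒x≡y v m)) v∈T) (x∈⁅x⁆ v) q≢x closed)
        where
        closed : ∀ {u w} → u ∈ₛ ⁅ v ⁆ → Step x g u w → w ∈ₛ ⁅ v ⁆ ⊎ w ≡ q
        closed u∈ (i , refl) with refl ← x∈⁅y⁆⇒x≡y v u∈ with f i
        ... | inj₁ e = inj₁ (subst (_∈ₛ ⁅ v ⁆) (sym e) (x∈⁅x⁆ v))
        ... | inj₂ e = inj₂ e

      -- If no arc led from `Y` to `v`, the contraction would not affect the arcs of `Y`, which
      -- would be a trap for `g` already.
      trap-enters : ∀ {u} → (t : Trap x (Step x (contract u)) T') → let open Trap t in
                    ∃₂ λ a i → a ∈ₛ Y × g a i ≡ v × (u ∈ₛ Y ⊎ u ≡ q)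
      trap-enters {u} t@(trap {Y} {q} Y⊆T' y∈Y q≢x exits) with any? (λ a → any? (λ i → a ∈ₛ? Y ×-dec g a i ≟ v))
      ... | yes (a , i , a∈Y , e) = a , i , a∈Y , e , subst (λ w → w ∈ₛ Y ⊎ w ≡ q) (redirect-at v u e) (exits a∈Y (i , refl))
      ... | no none = contradiction (trap (T'⊆T ∘ Y⊆T') y∈Y q≢x
              λ { {a} a∈Y (i , refl) → subst (λ w → w ∈ₛ Y ⊎ w ≡ q) (redirect-off u (λ e → none (a , i , a∈Y , e))) (exits a∈Y (i , refl)) }) fan

      -- A new trap would have an arc redirected to `x`, but `x` can neither lie in a trap nor be
      -- its exit.
      contract-x-fan : ¬ Trap x (Step x (contract x)) T'
      contract-x-fan t with trap-enters t
      ... | a , i , a∈Y , e , inj₁ x∈Y = x∉T (T'⊆T (Trap.Y⊆T t x∈Y))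
      ... | a , i , a∈Y , e , inj₂ x≡q = Trap.q≢x t (sym x≡q)

      -- Y₀ ∪ Y₁ ∪ {v} can only be left towards q₀ and q₁, and then Y₀ ∩ Y₁ can only be left towards v.
      one-contraction-fan : AtMostOneIn v → ∀ {u₀ u₁} → (∀ i → g v i ≡ u₀ ⊎ g v i ≡ u₁) →
                            Trap x (Step x (contract u₀)) T' → ¬ Trap x (Step x (contract u₁)) T'
      one-contraction-fan once {u₀} {u₁} outs t₀@(trap {Y₀} {q₀} Y₀⊆ y₀∈ q₀≢x exits₀) t₁@(trap {Y₁} {q₁} Y₁⊆ y₁∈ q₁≢x exits₁)
        with trap-enters t₀ | trap-enters t₁
      ... | a , i , a∈Y₀ , e , out₀ | a' , i' , a'∈Y₁ , e' , out₁
        -- The only arc entering `v` starts in both traps, so their intersection is nonempty.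
        with refl ← once (T'⊆T (Y₀⊆ a∈Y₀) , e) (T'⊆T (Y₁⊆ a'∈Y₁) , e') =
        fan (trap {Y = Y₀ ∩ Y₁} (T'⊆T ∘ Y₀⊆ ∘ proj₁ ∘ x∈p∩q⁻ Y₀ Y₁) (x∈p∩q⁺ (a∈Y₀ , a'∈Y₁)) v≢x closed)
        where
        U : Subset n
        U = (Y₀ ∪ Y₁) ∪ ⁅ v ⁆
        in₀ : ∀ {w} → w ∈ₛ Y₀ → w ∈ₛ U
        in₀ m = x∈p∪q⁺ (inj₁ (x∈p∪q⁺ (inj₁ m)))
        in₁ : ∀ {w} → w ∈ₛ Y₁ → w ∈ₛ U
        in₁ m = x∈p∪q⁺ (inj₁ (x∈p∪q⁺ {p = Y₀} (inj₂ m)))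
        inv : v ∈ₛ U
        inv = x∈p∪q⁺ {p = Y₀ ∪ Y₁} (inj₂ (x∈⁅x⁆ v))
        U⊆T : U ⊆ₛ T
        U⊆T m with x∈p∪q⁻ (Y₀ ∪ Y₁) ⁅ v ⁆ m
        ... | inj₂ m' = subst (_∈ₛ T) (sym (x∈⁅y⁆⇒x≡y v m')) v∈T
        ... | inj₁ m' = [ T'⊆T ∘ Y₀⊆ , T'⊆T ∘ Y₁⊆ ]′ (x∈p∪q⁻ Y₀ Y₁ m')
        step₀ : ∀ {w} → w ∈ₛ Y₀ → ∀ k → g w k ≢ v → g w k ∈ₛ Y₀ ⊎ g w k ≡ q₀
        step₀ w∈ k ne = subst (λ z → z ∈ₛ Y₀ ⊎ z ≡ q₀) (redirect-off u₀ ne) (exits₀ w∈ (k , refl))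
        step₁ : ∀ {w} → w ∈ₛ Y₁ → ∀ k → g w k ≢ v → g w k ∈ₛ Y₁ ⊎ g w k ≡ q₁
        step₁ w∈ k ne = subst (λ z → z ∈ₛ Y₁ ⊎ z ≡ q₁) (redirect-off u₁ ne) (exits₁ w∈ (k , refl))
        union-escapes : ∀ {q} → q ≢ x → q₀ ∈ₛ U ⊎ q₀ ≡ q → ¬ (q₁ ∈ₛ U ⊎ q₁ ≡ q)
        union-escapes {q} q≢x ok₀ ok₁ = fan (trap U⊆T inv q≢x λ { m (k , refl) → closedU m k })
          where
          from₀ : ∀ {w} → w ∈ₛ Y₀ ⊎ w ≡ q₀ → w ∈ₛ U ⊎ w ≡ q
          from₀ (inj₁ m)    = inj₁ (in₀ m)
          from₀ (inj₂ refl) = ok₀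
          from₁ : ∀ {w} → w ∈ₛ Y₁ ⊎ w ≡ q₁ → w ∈ₛ U ⊎ w ≡ q
          from₁ (inj₁ m)    = inj₁ (in₁ m)
          from₁ (inj₂ refl) = ok₁
          closedU : ∀ {w} → w ∈ₛ U → ∀ k → g w k ∈ₛ U ⊎ g w k ≡ q
          closedU {w} m k with g w k ≟ v
          ... | yes e′ = inj₁ (subst (_∈ₛ U) (sym e′) inv)
          ... | no ne with x∈p∪q⁻ (Y₀ ∪ Y₁) ⁅ v ⁆ m
          ...   | inj₁ m' = [ (λ m₀ → from₀ (step₀ m₀ k ne)) , (λ m₁ → from₁ (step₁ m₁ k ne)) ]′ (x∈p∪q⁻ Y₀ Y₁ m')
          ...   | inj₂ m' with refl ← x∈⁅y⁆⇒x≡y v m' with outs k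
          ...     | inj₁ e′ = subst (λ z → z ∈ₛ U ⊎ z ≡ q) (sym e′) (from₀ out₀)
          ...     | inj₂ e′ = subst (λ z → z ∈ₛ U ⊎ z ≡ q) (sym e′) (from₁ out₁)
        meet : ∀ {w} → w ∈ₛ Y₀ ⊎ w ≡ q₀ → w ∈ₛ Y₁ ⊎ w ≡ q₁ → w ∈ₛ Y₀ ∩ Y₁
        meet (inj₁ m)    (inj₁ m')   = x∈p∩q⁺ (m , m')
        meet (inj₁ m)    (inj₂ refl) = contradiction (inj₁ (in₀ m)) (union-escapes q₀≢x (inj₂ refl))
        meet (inj₂ refl) (inj₁ m')   = contradiction (inj₂ refl) (union-escapes q₁≢x (inj₁ (in₁ m')))
        meet (inj₂ refl) (inj₂ refl) = contradiction (inj₂ refl) (union-escapes q₀≢x (inj₂ refl))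
        closed : ∀ {w z} → w ∈ₛ Y₀ ∩ Y₁ → Step x g w z → z ∈ₛ Y₀ ∩ Y₁ ⊎ z ≡ v
        closed {w} m (k , refl) with g w k ≟ v | x∈p∩q⁻ Y₀ Y₁ m
        ... | yes e′ | _       = inj₂ e′
        ... | no ne  | m₀ , m₁ = inj₁ (meet (step₀ m₀ k ne) (step₁ m₁ k ne))

      at-v-or-off : {P : Fin n → Set} → P v → (∀ {y} → y ∈ₛ T' → P y) → ∀ {y} → y ∈ₛ T → P y
      at-v-or-off Pv PT' {y} y∈ with y ≟ v
      ... | yes refl = Pv
      ... | no ne    = PT' (∈-∖⁺ y∈ ne)

      -- v is inserted into an order of T' below exactly the vertices of rank at least k.
      module _ (k : ℕ) (r : Fin n → ℕ) where

        insert : Fin n → ℕ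
        insert w with w ≟ v
        -- Old ranks become odd and that of `v` even, so there are no ties.
        ... | yes _ = 2 * k
        ... | no  _ = suc (2 * r w)

        insert-at : insert v ≡ 2 * k
        insert-at with v ≟ v
        ... | yes _ = refl
        ... | no ne = contradiction refl ne

        insert-off : ∀ {w} → w ≢ v → insert w ≡ suc (2 * r w)
        insert-off {w} ne with w ≟ v
        ... | yes e = contradiction e ne
        ... | no _  = refl

        insert-mono : ∀ {a b} → a ≢ v → b ≢ v → r a < r b → insert a < insert b
        insert-mono {a} {b} a≢ b≢ lt = subst₂ _<_ (sym (insert-off a≢)) (sym (insert-off b≢))
          (s≤s (≤-trans (n≤1+n _) (≤-trans (≤-reflexive (sym (*-suc 2 (r a)))) (*-monoʳ-≤ 2 lt))))

        insert-below : ∀ {w} → w ≢ v → k ≤ r w → insert v < insert w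
        insert-below w≢ k≤ = subst₂ _<_ (sym insert-at) (sym (insert-off w≢)) (s≤s (*-monoʳ-≤ 2 k≤))

        insert-above : ∀ {w} → w ≢ v → r w < k → insert w < insert v
        insert-above {w} w≢ <k = subst₂ _<_ (sym (insert-off w≢)) (sym insert-at)
          (≤-trans (≤-reflexive (sym (*-suc 2 (r w)))) (*-monoʳ-≤ 2 <k))

        insert-injective : (∀ {a b} → a ∈ₛ T' → b ∈ₛ T' → r a ≡ r b → a ≡ b) →
                           ∀ {a b} → a ∈ₛ T → b ∈ₛ T → insert a ≡ insert b → a ≡ b
        insert-injective inj {a} {b} a∈ b∈ e with a ≟ v | b ≟ v
        ... | yes refl | yes refl = refl
        ... | yes refl | no b≢    = contradiction e (even≢odd k (r b))
        ... | no a≢    | yes refl = contradiction (sym e) (even≢odd k (r a))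
        ... | no a≢    | no b≢    = inj (∈-∖⁺ a∈ a≢) (∈-∖⁺ b∈ b≢) (*-cancelˡ-≡ (r a) (r b) 2 (suc-injective e))

        -- Arcs not entering `v` survive the contraction. For one that was redirected to `u`, `via`
        -- has to make up with the position of `v`.
        transfer : ∀ (_≺_ : ℕ → ℕ → Set) → (∀ {a b} → a ≢ v → b ≢ v → r a ≺ r b → insert a ≺ insert b) →
                   ∀ {u y} → y ∈ₛ T' →
                   (∀ {i} → g y i ≡ v → u ≡ x ⊎ (u ∈ₛ T' × r u ≺ r y) → Towards _≺_ g T insert y) →
                   Towards _≺_ (contract u) T' r y → Towards _≺_ g T insert y
        transfer _≺_ mono {u} {y} y∈ via (i , step) with g y i ≟ v
        ... | yes e = via e step
        transfer _≺_ mono {u} {y} y∈ via (i , inj₁ e)         | no ne = i , inj₁ e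
        transfer _≺_ mono {u} {y} y∈ via (i , inj₂ (m , lt))  | no ne = i , inj₂ (T'⊆T m , mono ne (proj₂ (∈-∖⁻ y∈)) lt)

      -- `v` is placed right next to `u`, on the side of `w`. Then `u` and `w` lie on opposite sides
      -- of `v`, and any other vertex above or below `u` is equally above or below `v`.
      lift-contraction : ∀ {u w r} → u ∈ₛ T' → w ∈ₛ T' → u ≢ w → ∀ {i j} → g v i ≡ u → g v j ≡ w →
                         LowHigh (contract u) T' r → ∃ λ r' → LowHigh g T r'
      lift-contraction {u} {w} {r} u∈ w∈ u≢w {i} {j} gi gj order = by-cases (<-cmp (r w) (r u))
        where
        open LowHigh order
        u≢v = proj₂ (∈-∖⁻ u∈)
        w≢v = proj₂ (∈-∖⁻ w∈)
        place : ∀ k → (∀ {y} → r u < r y → k ≤ r y) → (∀ {y} → r y < r u → r y < k) →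
                Towards _<_ g T (insert k r) v → Towards _>_ g T (insert k r) v → LowHigh g T (insert k r)
        place k up down low-v high-v = record
          { injective = insert-injective k r injective
          ; low  = at-v-or-off low-v low'
          ; high = at-v-or-off high-v high'
          }
          where
          low' : ∀ {y} → y ∈ₛ T' → Towards _<_ g T (insert k r) y
          low' {y} y∈ = transfer k r _<_ (insert-mono k r) y∈
            (λ { e (inj₁ refl) → contradiction (T'⊆T u∈) x∉T
               ; {l} e (inj₂ (_ , lt)) → l , inj₂ (subst (_∈ₛ T) (sym e) v∈T , subst (λ z → insert k r z < insert k r y) (sym e) (insert-below k r (proj₂ (∈-∖⁻ y∈)) (up {y} lt))) })
            (low y∈)
          high' : ∀ {y} → y ∈ₛ T' → Towards _>_ g T (insert k r) y
          high' {y} y∈ = transfer k r _>_ (λ a≢ b≢ → insert-mono k r b≢ a≢) y∈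
            (λ { e (inj₁ refl) → contradiction (T'⊆T u∈) x∉T
               ; {l} e (inj₂ (_ , lt)) → l , inj₂ (subst (_∈ₛ T) (sym e) v∈T , subst (λ z → insert k r z > insert k r y) (sym e) (insert-above k r (proj₂ (∈-∖⁻ y∈)) (down {y} lt))) })
            (high y∈)
        below : ∀ k {l z} → z ∈ₛ T' → g v l ≡ z → r z < k → Towards _<_ g T (insert k r) v
        below k {l} z∈ refl lt = l , inj₂ (T'⊆T z∈ , insert-above k r (proj₂ (∈-∖⁻ z∈)) lt)
        above : ∀ k {l z} → z ∈ₛ T' → g v l ≡ z → k ≤ r z → Towards _>_ g T (insert k r) v
        above k {l} z∈ refl le = l , inj₂ (T'⊆T z∈ , insert-below k r (proj₂ (∈-∖⁻ z∈)) le)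
        by-cases : _ → _
        by-cases (tri< w<u _ _) = _ , place (r u) <⇒≤ (λ lt → lt) (below _ w∈ gj w<u) (above _ u∈ gi ≤-refl)
        by-cases (tri≈ _ e _)   = contradiction (sym (injective w∈ u∈ e)) u≢w
        by-cases (tri> _ _ u<w) = _ , place (suc (r u)) (λ lt → lt) m<n⇒m<1+n (below _ u∈ gi ≤-refl) (above _ w∈ gj u<w)

      -- Only one vertex y may see v; v is put on the side of y opposite to y's other out-neighbour.
      lift-contraction-x : AtMostOneIn v → ∀ {i} → g v i ≡ x → ∀ {r} → LowHigh (contract x) T' r → ∃ λ r' → LowHigh g T r'
      lift-contraction-x once {i} to-x {r} order = by-cases (any? (λ y → y ∈ₛ? T' ×-dec any? (λ j → g y j ≟ v)))
        where
        open LowHigh order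
        place : ∀ k → (∀ {y j} → y ∈ₛ T' → g y j ≡ v → Towards _<_ g T (insert k r) y × Towards _>_ g T (insert k r) y) →
                LowHigh g T (insert k r)
        place k special = record
          { injective = insert-injective k r injective
          ; low  = at-v-or-off (i , inj₁ to-x) λ y∈ → transfer k r _<_ (insert-mono k r) y∈ (λ e _ → proj₁ (special y∈ e)) (low y∈)
          ; high = at-v-or-off (i , inj₁ to-x) λ y∈ → transfer k r _>_ (λ a≢ b≢ → insert-mono k r b≢ a≢) y∈ (λ e _ → proj₂ (special y∈ e)) (high y∈)
          }
        other : Fin 2 → Fin 2
        other zero       = suc zero
        other (suc zero) = zero
        other≢ : ∀ j → other j ≢ j
        other≢ zero       ()
        other≢ (suc zero) ()
        cover : ∀ j l → l ≡ j ⊎ l ≡ other j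
        cover zero       zero       = inj₁ refl
        cover zero       (suc zero) = inj₂ refl
        cover (suc zero) zero       = inj₂ refl
        cover (suc zero) (suc zero) = inj₁ refl
        by-cases : _ → _
        by-cases (no none) = _ , place 0 (λ y∈ e → contradiction (_ , y∈ , _ , e) none)
        by-cases (yes (y , y∈ , j , e)) = next (into (T'⊆T y∈) (other j))
          where
          y≢v = proj₂ (∈-∖⁻ y∈)
          only : ∀ {k} → Towards _<_ g T (insert k r) y → Towards _>_ g T (insert k r) y →
                 ∀ {y' j'} → y' ∈ₛ T' → g y' j' ≡ v → Towards _<_ g T (insert k r) y' × Towards _>_ g T (insert k r) y'
          only lo hi {y'} y'∈ e' with refl ← once (T'⊆T y'∈ , e') (T'⊆T y∈ , e) = lo , hi
          z≢v : g y (other j) ≢ v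
          z≢v e' = other≢ j (cong proj₂ (once (T'⊆T y∈ , e') (T'⊆T y∈ , e)))
          next : _ → _
          -- `x` counts as both below and above `y`, so any position of `v` works.
          next (inj₂ z≡x) = _ , place 0 (only (other j , inj₁ z≡x) (other j , inj₁ z≡x))
          next (inj₁ z∈) with <-cmp (r (g y (other j))) (r y)
          ... | tri< lt _ _ = _ , place (suc (r y)) (only
                  (other j , inj₂ (z∈ , insert-mono (suc (r y)) r z≢v y≢v lt))
                  (j , inj₂ (subst (_∈ₛ T) (sym e) v∈T , subst (λ z → insert (suc (r y)) r z > insert (suc (r y)) r y) (sym e) (insert-above (suc (r y)) r y≢v ≤-refl))))
          ... | tri> _ _ gt = _ , place (r y) (only
                  (j , inj₂ (subst (_∈ₛ T) (sym e) v∈T , subst (λ z → insert (r y) r z < insert (r y) r y) (sym e) (insert-below (r y) r y≢v ≤-refl)))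
                  (other j , inj₂ (z∈ , insert-mono (r y) r y≢v z≢v gt)))
          -- Equal ranks mean that the other out-neighbour is `y` itself, and then `y` alone is a
          -- trap with exit `v`.
          ... | tri≈ _ eq _ = contradiction
                  (trap {Y = ⁅ y ⁆} {q = v} (λ m → subst (_∈ₛ T) (sym (x∈⁅y⁆⇒x≡y y m)) (T'⊆T y∈)) (x∈⁅x⁆ y) v≢x closed) fan
            where
            closed : ∀ {a w} → a ∈ₛ ⁅ y ⁆ → Step x g a w → w ∈ₛ ⁅ y ⁆ ⊎ w ≡ v
            closed a∈ (l , refl) with refl ← x∈⁅y⁆⇒x≡y y a∈ with cover j l
            ... | inj₁ refl = inj₂ e
            ... | inj₂ refl = inj₁ (subst (_∈ₛ ⁅ y ⁆) (sym (injective (∈-∖⁺ z∈ z≢v) y∈ eq)) (x∈⁅x⁆ y))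

  -- Induction on `T`. A vertex entered at most once is contracted into `x` if it has an arc there,
  -- and otherwise into an out-neighbour for which no trap arises; then it is inserted into the
  -- order of the rest.
  low-high : ∀ {T} → Acc _⊂_ T → ∀ {g} → x ∉ₛ T → ¬ Trap x (Step x g) T →
             (∀ {v} → v ∈ₛ T → ∀ i → g v i ∈ₛ T ⊎ g v i ≡ x) → DN (∃ λ r → LowHigh g T r)
  low-high {T} (acc rs) {g} x∉T fan into with nonempty? T
  ... | no empty = return ((λ _ → 0) , record
          { injective = λ v∈T → contradiction (_ , v∈T) empty
          ; low       = λ v∈T → contradiction (_ , v∈T) empty
          ; high      = λ v∈T → contradiction (_ , v∈T) empty })
  ... | yes (v₀ , v₀∈T) = do
    v , v∈T , once ← exists-AtMostOneIn x∉T fan into v₀∈T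
    let recurse : ∀ {u} → u ∈ₛ T ∖ v ⊎ u ≡ x → ¬ Trap x (Step x (contract x∉T fan into v∈T u)) (T ∖ v) →
                  DN (∃ λ r → LowHigh (contract x∉T fan into v∈T u) (T ∖ v) r)
        recurse u-ok fan' = low-high (rs (∖-⊂ v∈T)) (λ m → x∉T (proj₁ (∈-∖⁻ m))) fan' (contract-into x∉T fan into v∈T u-ok)
    no ¬exit ← em {∃ λ i → g v i ≡ x}
      where yes (i , to-x) → do
              _ , order ← recurse (inj₂ refl) (contract-x-fan x∉T fan into v∈T)
              return (lift-contraction-x x∉T fan into v∈T once to-x order)
    let inside : ∀ i → g v i ∈ₛ T
        inside i = [ id , (λ e → contradiction (i , e) ¬exit) ]′ (into v∈T i)
        off : ∀ i j → (∀ l → l ≡ i ⊎ l ≡ j) → g v i ≢ v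
        off i j all e = two-exits x∉T fan into v∈T {g v j} (λ e → ¬exit (j , e))
          (λ l → [ (λ { refl → inj₁ e }) , (λ { refl → inj₂ refl }) ]′ (all l))
        in₀ : g v zero ∈ₛ T ∖ v
        in₀ = ∈-∖⁺ (inside zero) (off zero (suc zero) λ { zero → inj₁ refl ; (suc zero) → inj₂ refl })
        in₁ : g v (suc zero) ∈ₛ T ∖ v
        in₁ = ∈-∖⁺ (inside (suc zero)) (off (suc zero) zero λ { zero → inj₂ refl ; (suc zero) → inj₁ refl })
        u₀≢u₁ : g v zero ≢ g v (suc zero)
        u₀≢u₁ e = two-exits x∉T fan into v∈T {g v zero} (λ e → ¬exit (zero , e))
          λ { zero → inj₂ refl ; (suc zero) → inj₂ (sym e) }
    yes t₀ ← em {Trap x (Step x (contract x∉T fan into v∈T (g v zero))) (T ∖ v)}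
      where no fan₀ → do
              _ , order ← recurse (inj₁ in₀) fan₀
              return (lift-contraction x∉T fan into v∈T in₀ in₁ u₀≢u₁ refl refl order)
    _ , order ← recurse (inj₁ in₁) (one-contraction-fan x∉T fan into v∈T once
                  (λ { zero → inj₁ refl ; (suc zero) → inj₂ refl }) t₀)
    return (lift-contraction x∉T fan into v∈T in₁ in₀ (u₀≢u₁ ∘ sym) refl refl order)

-- Critical digraphs contain H₂

module _ (D : Digraph) {k : ℕ} {W : Subset (size D)} (crit : Critical D (suc k) W) where

  -- On at most one vertex a constant colouring is acyclic. Two vertices are needed to start with a
  -- nonempty piece `W ∖ x`.
  critical-two : DN (∃₂ λ u v → u ∈ₛ W × v ∈ₛ W × u ≢ v)
  critical-two none = proj₁ crit ((λ _ → zero) , λ x xs (p , u) inW _ → single x xs p u inW)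
    where
    same : ∀ {u v} → u ∈ₛ W → v ∈ₛ W → u ≡ v
    same {u} {v} u∈ v∈ with u ≟ v
    ... | yes e = e
    ... | no ne = contradiction (u , v , u∈ , v∈ , ne) none
    single : ∀ x xs → Walk D x xs x → Unique (x ∷ xs) → All (_∈ₛ W) (x ∷ xs) → ⊥
    single x xs p u (x∈ ∷ xs∈) with refl ← unique-constant u (All.map (λ m → same m x∈) xs∈) = arc-irrefl D {x} p

  record Piece (T : Subset (size D)) : Set where
    field
      {x s}  : V D
      s∈T    : s ∈ₛ T
      T⊆W    : T ⊆ₛ W
      x∈W    : x ∈ₛ W
      x∉T    : x ∉ₛ T
      exit   : OnlyExit D T W x

  minimal-piece : DN (∃ (IsMinimal Piece))
  minimal-piece = do
    x , s , x∈W , s∈W , x≢s ← critical-two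
    minimal Piece (W ∖ x) (record
      { s∈T = ∈-∖⁺ s∈W (x≢s ∘ sym) ; T⊆W = proj₁ ∘ ∈-∖⁻ ; x∈W = x∈W ; x∉T = λ m → proj₂ (∈-∖⁻ m) refl
      ; exit = λ {u} {v} _ v∈W _ → exits v v∈W })
    where
    exits : ∀ {x} v → v ∈ₛ W → v ∈ₛ W ∖ x ⊎ v ≡ x
    exits {x} v v∈W with v ≟ x
    ... | yes e = inj₂ e
    ... | no ne = inj₁ (∈-∖⁺ v∈W ne)

  module _ {T : Subset (size D)} (min : IsMinimal Piece T) where

    open Piece (proj₁ min)

    -- If `q` lies in `T` but not in `Y`, then `Y` is a smaller piece. Otherwise no arc leaves `Y`,
    -- since arcs from `T` end in `T` or at `x`; this contradicts `critical-exit`.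
    piece-fan : ¬ Trap x (λ u w → w ∈ₛ W × Arc D u w) T
    piece-fan (trap {Y} {q} Y⊆T y∈Y q≢x exits) with q ∈ₛ? T | q ∈ₛ? Y
    ... | yes q∈T | no q∉Y = proj₂ min Y (Y⊆T , q , q∈T , q∉Y) (record
            { s∈T = y∈Y ; T⊆W = T⊆W ∘ Y⊆T ; x∈W = T⊆W q∈T ; x∉T = q∉Y ; exit = λ u∈ v∈ a → exits u∈ (v∈ , a) })
    ... | _ | yes q∈Y = critical-exit D crit {Y} (T⊆W ∘ Y⊆T) y∈Y x∈W (x∉T ∘ Y⊆T)
            λ u∈ v∈ a → [ id , (λ { refl → q∈Y }) ]′ (exits u∈ (v∈ , a))
    ... | no q∉T | no _ = critical-exit D crit {Y} (T⊆W ∘ Y⊆T) y∈Y x∈W (x∉T ∘ Y⊆T) closed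
      where
      closed : ∀ {u v} → u ∈ₛ Y → v ∈ₛ W → Arc D u v → v ∈ₛ Y
      closed u∈ v∈ a with exits u∈ (v∈ , a)
      ... | inj₁ m    = m
      ... | inj₂ refl = contradiction (exit (Y⊆T u∈) v∈ a) [ q∉T , q≢x ]′

-- Monotone paths and cycles in a low-high order

module _ {n : ℕ} (r : Fin n → ℕ) where

  bounded : ∃ λ B → ∀ i → r i ≤ B
  bounded = go r
    where
    go : ∀ {n} (r : Fin n → ℕ) → ∃ λ B → ∀ i → r i ≤ B
    go {zero}  r = 0 , λ ()
    go {suc n} r with B , le ← go (r ∘ suc) =
      r zero ⊔ B , λ { zero → m≤m⊔n (r zero) B ; (suc i) → ≤-trans (le i) (m≤n⊔m (r zero) B) }

  extremum : ∀ {_≼_ : ℕ → ℕ → Set} → (∀ a b → a ≼ b ⊎ b ≼ a) → (∀ {a b c} → a ≼ b → b ≼ c → a ≼ c) → (∀ {a} → a ≼ a) →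
             ∀ x xs → ∃ λ m → m ∈ x ∷ xs × (∀ {z} → z ∈ x ∷ xs → r z ≼ r m)
  extremum tot tr rf x []       = x , here refl , λ { (here refl) → rf }
  extremum tot tr rf x (y ∷ ys) with m , m∈ , top ← extremum tot tr rf y ys | tot (r x) (r m)
  ... | inj₁ x≼m = m , there m∈ , λ { (here refl) → x≼m ; (there z∈) → top z∈ }
  ... | inj₂ m≼x = x , here refl , λ { (here refl) → rf ; (there z∈) → tr (top z∈) m≼x }

  maximum : ∀ x xs → ∃ λ m → m ∈ x ∷ xs × (∀ {z} → z ∈ x ∷ xs → r z ≤ r m)
  maximum = extremum ≤-total ≤-trans ≤-refl

  minimum : ∀ x xs → ∃ λ m → m ∈ x ∷ xs × (∀ {z} → z ∈ x ∷ xs → r z ≥ r m)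
  minimum = extremum (λ a b → ≤-total b a) (flip ≤-trans) ≤-refl

module _ (D : Digraph) {x : V D} {T : Subset (size D)} (x∉T : x ∉ₛ T) {g : V D → Fin 2 → V D}
         (g-arc : ∀ {v} → v ∈ₛ T → ∀ i → Arc D v (g v i)) {r : V D → ℕ} (order : LowHigh x g T r) where

  open LowHigh order

  -- Steps that advance along `_≺_` never return and can only end at `x`. The measure `μ` makes them
  -- terminate in either direction.
  exit-path : (_≺_ : ℕ → ℕ → Set) → (∀ {a b c} → a ≺ b → b ≺ c → a ≺ c) → (∀ {a} → ¬ a ≺ a) →
              (μ : V D → ℕ) → (∀ {u v} → r u ≺ r v → μ u < μ v) → (∀ {v} → v ∈ₛ T → Towards x _≺_ g T r v) →
              ∀ {v} → v ∈ₛ T → ∃ λ P → Walk D v P x × Unique P × All (λ w → w ∈ₛ T × r w ≺ r v) P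
  exit-path _≺_ tr irr μ decreasing towards {v} = go v (<-wellFounded (μ v))
    where
    go : ∀ v → Acc _<_ (μ v) → v ∈ₛ T → ∃ λ P → Walk D v P x × Unique P × All (λ w → w ∈ₛ T × r w ≺ r v) P
    go v (acc rs) v∈T with towards v∈T
    ... | i , inj₁ e = [] , subst (Arc D v) e (g-arc v∈T i) , [] , []
    ... | i , inj₂ (w∈T , w≺v) with P , p , u , beyond ← go (g v i) (rs (decreasing w≺v)) w∈T =
      g v i ∷ P , (g-arc v∈T i , p) , ∷-unique (λ w∈P → irr (proj₂ (All.lookup beyond w∈P))) u ,
      (w∈T , w≺v) ∷ All.map (λ (z∈T , z≺w) → z∈T , tr z≺w w≺v) beyond

  descent : ∀ {v} → v ∈ₛ T → ∃ λ P → Walk D v P x × Unique P × All (λ w → w ∈ₛ T × r w < r v) P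
  descent = exit-path _<_ <-trans (<-irrefl refl) r id low

  ascent : ∀ {v} → v ∈ₛ T → ∃ λ P → Walk D v P x × Unique P × All (λ w → w ∈ₛ T × r w > r v) P
  ascent = exit-path _>_ (flip <-trans) (<-irrefl refl) (λ v → B ∸ r v) (λ lt → ∸-monoʳ-< lt (r≤B _)) high
    where
    B = proj₁ (bounded r)
    r≤B = proj₂ (bounded r)

  TopOfCycle BottomOfCycle : V D → Set
  TopOfCycle    v = ∃ λ xs → DirectedCycle D v xs × All (λ w → w ∈ₛ T × r w < r v) xs
  BottomOfCycle v = ∃ λ xs → DirectedCycle D v xs × All (λ w → w ∈ₛ T × r w > r v) xs

  -- Ranks keep the parts disjoint: `P` lies below `a`, `A` from `a` up to below `v`, `C` from above
  -- `v` up to `c`, and `R` above `c`.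
  top∧bottom⇒H₂ : ∀ {v} → v ∈ₛ T → TopOfCycle v → BottomOfCycle v → Subdivision H₂ D
  top∧bottom⇒H₂ {v} v∈T ([] , (p , _) , _) _ = contradiction p (arc-irrefl D)
  top∧bottom⇒H₂ {v} v∈T (_ ∷ _ , _ , _) ([] , (p , _) , _) = contradiction p (arc-irrefl D)
  top∧bottom⇒H₂ {v} v∈T (A@(a₀ ∷ as) , cycA , lowA) (C@(c₀ ∷ cs) , cycC , highC)
    with a , a∈ , a-min ← minimum r a₀ as | c , c∈ , c-max ← maximum r c₀ cs
    with P , p , uniqP , lowP ← descent (proj₁ (All.lookup lowA a∈)) | R , q , uniqR , highR ← ascent (proj₁ (All.lookup highC c∈)) =
    subdivision-H₂ cycA cycC a∈ c∈ p q
      (∷-unique x∉ (∷-unique v∉ (Unique.++⁺ (tail cycA) (Unique.++⁺ (tail cycC) (Unique.++⁺ uniqP uniqR P#R) C#PR) A#CPR)))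
    where
    tail : ∀ {xs} → DirectedCycle D v xs → Unique xs
    tail (_ , _ ∷ u) = u
    rA : ∀ {z} → z ∈ A → r z < r v
    rA m = proj₂ (All.lookup lowA m)
    rC : ∀ {z} → z ∈ C → r v < r z
    rC m = proj₂ (All.lookup highC m)
    rP : ∀ {z} → z ∈ P → r z < r a
    rP m = proj₂ (All.lookup lowP m)
    rR : ∀ {z} → z ∈ R → r c < r z
    rR m = proj₂ (All.lookup highR m)
    rP′ : ∀ {z} → z ∈ P → r z < r v
    rP′ m = <-trans (rP m) (rA a∈)
    rR′ : ∀ {z} → z ∈ R → r v < r z
    rR′ m = <-trans (rC c∈) (rR m)
    P#R : ∀ {z} → ¬ (z ∈ P × z ∈ R)
    P#R (m , m') = <-asym (rP′ m) (rR′ m')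
    C#PR : ∀ {z} → ¬ (z ∈ C × z ∈ P ++ R)
    C#PR (m , m') = [ (λ m″ → <-asym (rC m) (rP′ m″)) , (λ m″ → ≤⇒≯ (c-max m) (rR m″)) ]′ (∈-++⁻ P m')
    A#CPR : ∀ {z} → ¬ (z ∈ A × z ∈ C ++ P ++ R)
    A#CPR (m , m') = [ (λ m″ → <-asym (rA m) (rC m″)) ,
      (λ m″ → [ (λ mP → ≤⇒≯ (a-min m) (rP mP)) , (λ mR → <-asym (rA m) (rR′ mR)) ]′ (∈-++⁻ P m″)) ]′ (∈-++⁻ C m')
    parts : ∀ {z} → z ∈ A ++ C ++ P ++ R → z ∈ₛ T × r z ≢ r v
    parts m with ∈-++⁻ A m
    ... | inj₁ mA = proj₁ (All.lookup lowA mA) , λ e → <-irrefl e (rA mA)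
    ... | inj₂ m' with ∈-++⁻ C m'
    ...   | inj₁ mC = proj₁ (All.lookup highC mC) , λ e → <-irrefl (sym e) (rC mC)
    ...   | inj₂ m″ with ∈-++⁻ P m″
    ...     | inj₁ mP = proj₁ (All.lookup lowP mP) , λ e → <-irrefl e (rP′ mP)
    ...     | inj₂ mR = proj₁ (All.lookup highR mR) , λ e → <-irrefl (sym e) (rR′ mR)
    v∉ : v ∉ A ++ C ++ P ++ R
    v∉ m = proj₂ (parts m) refl
    x∉ : x ∉ v ∷ A ++ C ++ P ++ R
    x∉ (here refl) = x∉T v∈T
    x∉ (there m)   = x∉T (proj₁ (parts m))

  -- The cycle is restarted at its vertex of largest rank; injectivity of `r` makes the inequalities
  -- strict.
  top-of : ∀ {y xs} → DirectedCycle D y xs → All (_∈ₛ T) (y ∷ xs) → ∃ λ v → v ∈ y ∷ xs × TopOfCycle v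
  top-of {y} {xs} cyc inT with v , v∈ , top ← maximum r y xs with zs , cyc' , zs⊆ ← rotate-cycle D cyc v∈ =
    v , v∈ , zs , cyc' , All.tabulate λ m → All.lookup inT (zs⊆ m) ,
      ≤∧≢⇒< (top (zs⊆ m)) (λ e → unique-head (proj₂ cyc') (subst (_∈ zs) (injective (All.lookup inT (zs⊆ m)) (All.lookup inT v∈) e) m))

  bottom-of : ∀ {y xs} → DirectedCycle D y xs → All (_∈ₛ T) (y ∷ xs) → ∃ λ v → v ∈ y ∷ xs × BottomOfCycle v
  bottom-of {y} {xs} cyc inT with v , v∈ , bottom ← minimum r y xs with zs , cyc' , zs⊆ ← rotate-cycle D cyc v∈ =
    v , v∈ , zs , cyc' , All.tabulate λ m → All.lookup inT (zs⊆ m) ,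
      ≤∧≢⇒< (bottom (zs⊆ m)) (λ e → unique-head (proj₂ cyc') (subst (_∈ zs) (injective (All.lookup inT (zs⊆ m)) (All.lookup inT v∈) (sym e)) m))

  -- The largest vertex of a cycle has colour one, so no cycle has colour zero throughout. If all of
  -- a cycle has colour one, its smallest vertex is also the top of some cycle, which gives `H₂`.
  H₂-free⇒2-colourable : ¬ Subdivision H₂ D → DN (Colourable D 2 T)
  H₂-free⇒2-colourable free = do
    top? ← DN-∀ (λ v → em {TopOfCycle v})
    return (colour top? , colours top?)
    where
    module _ (top? : ∀ v → Dec (TopOfCycle v)) where
      colour : V D → Fin 2
      colour v with top? v
      ... | yes _ = suc zero
      ... | no  _ = zero
      is-top : ∀ {v} → colour v ≡ suc zero → TopOfCycle v
      is-top {v} e with yes t ← top? v = t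
      not-top : ∀ {v} → colour v ≡ zero → ¬ TopOfCycle v
      not-top {v} e with no nt ← top? v = nt
      colours : Colours D T colour
      colours y ys cyc inT mono with colour y in colour-y
      ... | zero with v , v∈ , t ← top-of cyc inT = not-top (same v∈) t
        where
        same : ∀ {v} → v ∈ y ∷ ys → colour v ≡ zero
        same (here refl) = colour-y
        same (there m)   = All.lookup mono m
      ... | suc zero with v , v∈ , bot ← bottom-of cyc inT = free (top∧bottom⇒H₂ (All.lookup inT v∈) (is-top (same v∈)) bot)
        where
        same : ∀ {v} → v ∈ y ∷ ys → colour v ≡ suc zero
        same (here refl) = colour-y
        same (there m)   = All.lookup mono m

critical⇒H₂ : ∀ D {W} → Critical D 3 W → DN (Subdivision H₂ D)
critical⇒H₂ D {W} crit free = (do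
  T , min ← minimal-piece D crit
  let open Piece (proj₁ min)
  g , g∈N , fan ← two-arcs x x∉T N (λ t → piece-fan D crit min (trap-antitone x (λ _ (w∈W , a) → ∈-filter⁺ (out? _) (∈-allFin _) (w∈W , a)) t))
  let g-out : ∀ {v} → v ∈ₛ T → ∀ i → g v i ∈ₛ W × Arc D v (g v i)
      g-out v∈T i = proj₂ (∈-filter⁻ (out? _) {xs = allFin _} (g∈N _ v∈T i))
  r , order ← low-high x (⊂-wellFounded T) x∉T fan (λ v∈T i → exit v∈T (proj₁ (g-out v∈T i)) (proj₂ (g-out v∈T i)))
  col ← H₂-free⇒2-colourable D x∉T (λ v∈T i → proj₂ (g-out v∈T i)) order free
  return (one-exit-not-colourable D crit T⊆W s∈T exit col)) id
  where
  out? : ∀ u w → Dec (w ∈ₛ W × Arc D u w)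
  out? u w = w ∈ₛ? W ×-dec arc? D u w
  N : V D → List (V D)
  N u = filter (out? u) (allFin (size D))

-- Critical digraphs contain H₁

first : {A : Set} {P : A → Set} → Decidable P → ∀ xs → Any P xs →
        ∃ λ ys → ∃₂ λ y zs → xs ≡ ys ++ y ∷ zs × P y × All (¬_ ∘ P) ys
first P? (x ∷ xs) some with P? x | some
... | yes p | _        = [] , x , xs , refl , p , []
... | no ¬p | here p   = contradiction p ¬p
... | no ¬p | there s with ys , y , zs , refl , p , none ← first P? xs s = x ∷ ys , y , zs , refl , p , ¬p ∷ none

module _ (D : Digraph) where

  open DecMembership (_≟_ {size D}) using (_∈?_)

  -- Unlike in Walk, the list includes the last vertex, and may be empty.
  Trail : V D → List (V D) → V D → Set
  Trail u []       v = u ≡ v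
  Trail u (w ∷ ws) v = Arc D u w × Trail w ws v

  trail-++ : ∀ {u} xs {v ys w} → Trail u xs v → Trail v ys w → Trail u (xs ++ ys) w
  trail-++ []       refl    q = q
  trail-++ (x ∷ xs) (a , p) q = a , trail-++ xs p q

  trail-end : ∀ {u} xs {v} → Trail u xs v → v ∈ u ∷ xs
  trail-end []       refl    = here refl
  trail-end (x ∷ xs) (_ , p) = there (trail-end xs p)

  trail-walk : ∀ {u} xs {v zs w} → Trail u (xs ++ v ∷ zs) w → Walk D u xs v
  trail-walk []       (a , _) = a
  trail-walk (x ∷ xs) (a , p) = a , trail-walk xs p

  module _ {P : V D → Set} (Q : Fin 3 → List (V D)) (disjoint : ∀ {w i j} → w ∈ Q i → w ∈ Q j → i ≡ j) where

    -- The inner vertices are listed as `w ∷ ws` because `d` needs an image. They may meet the third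
    -- list.
    record Segment : Set where
      field
        {i j}   : Fin 3
        {u v w} : V D
        {ws}    : List (V D)
        i≢j     : i ≢ j
        u∈Qi    : u ∈ Q i
        v∈Qj    : v ∈ Q j
        walk    : Walk D u (w ∷ ws) v
        inside  : All P (w ∷ ws)
        avoid-i : All (_∉ Q i) (w ∷ ws)
        avoid-j : All (_∉ Q j) (w ∷ ws)

    Meets : List (V D) → Fin 3 → Set
    Meets xs i = Any (_∈ Q i) xs

    meets? : ∀ xs i → Dec (Meets xs i)
    meets? xs i = Any.any? (_∈? Q i) xs

    -- In a shortest suffix meeting all three lists, the list met by its first vertex is not met again.
    segment : ∀ {u} xs {v} → Trail u xs v → All P xs → (∀ i → Meets (u ∷ xs) i) → Segment
    segment [] p inP meets with meets zero | meets (suc zero)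
    ... | here m | here m' with () ← disjoint m m'
    segment {u} (w ∷ ws) {v} (a , p) (Pw ∷ inP) meets with all? (meets? (w ∷ ws))
    ... | yes meets' = segment ws p inP meets'
    ... | no ¬meets with k , ¬k ← ¬∀⟶∃¬ 3 _ (meets? (w ∷ ws)) ¬meets = from-u
      where
      i j : Fin 3
      i = punchIn k zero
      j = punchIn k (suc zero)
      avoid-k : All (_∉ Q k) (w ∷ ws)
      avoid-k = All.tabulate λ m m' → ¬k (lose m m')
      u∈Qk : u ∈ Q k
      u∈Qk with meets k
      ... | here m  = m
      ... | there m = contradiction m ¬k
      later : ∀ l → Meets (w ∷ ws) (punchIn k l)
      later l with meets (punchIn k l)
      ... | here m  = contradiction (disjoint m u∈Qk) (punchInᵢ≢i k l)
      ... | there m = m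
      cut : ∀ {l y zs} z ys → k ≢ l → w ∷ ws ≡ (z ∷ ys) ++ y ∷ zs → y ∈ Q l → All (_∉ Q l) (z ∷ ys) → Segment
      cut z ys k≢l e y∈ none = record
        { i≢j = k≢l ; u∈Qi = u∈Qk ; v∈Qj = y∈
        ; walk = trail-walk (z ∷ ys) (subst (λ l → Trail u l v) e (a , p))
        ; inside = All.++⁻ˡ (z ∷ ys) (subst (All P) e (Pw ∷ inP))
        ; avoid-i = All.++⁻ˡ (z ∷ ys) (subst (All (_∉ Q k)) e avoid-k)
        ; avoid-j = none }
      from-u : Segment
      from-u with first (_∈? Q i) (w ∷ ws) (later zero)
      ... | z ∷ ys , y , zs , e , y∈ , none = cut z ys (punchInᵢ≢i k zero ∘ sym) e y∈ none
      -- The next vertex already lies in `Q i`, hence not in `Q j`, so the walk to `Q j` has an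
      -- inner vertex.
      ... | [] , y , zs , refl , y∈ , _ with first (_∈? Q j) (w ∷ ws) (later (suc zero))
      ...   | z ∷ ys , y' , zs' , e , y'∈ , none = cut z ys (punchInᵢ≢i k (suc zero) ∘ sym) e y'∈ none
      ...   | [] , y' , zs' , refl , y'∈ , _ with () ← punchIn-injective k zero (suc zero) (disjoint y∈ y'∈)

  -- The branch vertex `q` and reachability without it

  module _ {W : Subset (size D)} (crit : Critical D 3 W) {T : Subset (size D)} (min : IsMinimal (Piece D crit) T) where

    open Piece (proj₁ min)

    -- x reaches every vertex of W ∖ Z inside W ∖ Z, stated by closed sets instead of walks.
    Spans : Subset (size D) → Set
    Spans Z = ∀ Y → x ∈ₛ Y → (∀ {u} → u ∈ₛ Y → u ∈ₛ W × u ∉ₛ Z) →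
              (∀ {u v} → u ∈ₛ Y → v ∈ₛ W → v ∉ₛ Z → Arc D u v → v ∈ₛ Y) →
              ∀ {v} → v ∈ₛ W → v ∉ₛ Z → v ∈ₛ Y

    record Unspanned (Z : Subset (size D)) : Set where
      constructor unspanned
      field
        {z}   : V D
        z∈Z   : z ∈ₛ Z
        Z⊆T   : Z ⊆ₛ T
        spans : Spans Z

    -- `T` is left only towards `x`, which lies in `Y`, so no arc leaves `Y ∪ T`; by `critical-exit`
    -- this union is all of `W`.
    T-unspanned : Unspanned T
    T-unspanned = unspanned s∈T id spans
      where
      spans : Spans T
      spans Y x∈Y Y⊆ closed {v} v∈W v∉T with v ∈ₛ? Y
      ... | yes v∈Y = v∈Y
      ... | no v∉Y  = ⊥-elim (critical-exit D crit {Y ∪ T} sub (x∈p∪q⁺ (inj₁ x∈Y)) v∈W ([ v∉Y , v∉T ]′ ∘ x∈p∪q⁻ Y T) closed')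
        where
        sub : Y ∪ T ⊆ₛ W
        sub m = [ proj₁ ∘ Y⊆ , T⊆W ]′ (x∈p∪q⁻ Y T m)
        closed' : ∀ {a b} → a ∈ₛ Y ∪ T → b ∈ₛ W → Arc D a b → b ∈ₛ Y ∪ T
        closed' {a} {b} a∈ b∈W arc with b ∈ₛ? T | x∈p∪q⁻ Y T a∈
        ... | yes b∈T | _        = x∈p∪q⁺ {p = Y} (inj₂ b∈T)
        ... | no b∉T  | inj₁ a∈Y = x∈p∪q⁺ (inj₁ (closed a∈Y b∈W b∉T arc))
        ... | no b∉T  | inj₂ a∈T with exit a∈T b∈W arc
        ...   | inj₁ b∈T  = contradiction b∈T b∉T
        ...   | inj₂ refl = x∈p∪q⁺ (inj₁ x∈Y)

    -- A minimal unspanned set is a singleton, as otherwise a vertex entered from outside could be removed.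
    single-unspanned : DN (∃ λ q → q ∈ₛ T × ∃ λ Z → q ∈ₛ Z × (∀ z → z ∈ₛ Z → z ≡ q) × Spans Z)
    single-unspanned = do
      Z , unspanned {q} q∈Z Z⊆T spans , minZ ← minimal Unspanned T T-unspanned
      no ¬other ← em {∃ λ z → z ∈ₛ Z × z ≢ q}
        where yes (z , z∈Z , z≢q) → do
                yes (u , v , u∈W , u∉Z , v∈Z , a) ← em {∃₂ λ u v → u ∈ₛ W × u ∉ₛ Z × v ∈ₛ Z × Arc D u v}
                  -- Otherwise no arc would leave the complement of `Z` in `W`, which contains `x`.
                  where no none → ⊥-elim (critical-exit D crit {select (outside? Z)} (proj₁ ∘ ∈-select⁻ (outside? Z))
                          (∈-select⁺ (outside? Z) (x∈W , x∉T ∘ Z⊆T)) (T⊆W (Z⊆T q∈Z)) (λ m → proj₂ (∈-select⁻ (outside? Z) m) q∈Z)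
                          (λ {u} {v} u∈ v∈W a → ∈-select⁺ (outside? Z) (v∈W , λ v∈Z →
                            none (u , v , proj₁ (∈-select⁻ (outside? Z) u∈) , proj₂ (∈-select⁻ (outside? Z) u∈) , v∈Z , a))))
                ⊥-elim (minZ (Z ∖ v) (∖-⊂ v∈Z) (unspanned (proj₂ (remaining v q∈Z z∈Z z≢q)) (Z⊆T ∘ proj₁ ∘ ∈-∖⁻) (shrink Z⊆T spans u∈W u∉Z v∈Z a)))
      return (q , Z⊆T q∈Z , Z , q∈Z , (λ _ → equal ¬other) , spans)
      where
      outside? : ∀ Z u → Dec (u ∈ₛ W × u ∉ₛ Z)
      outside? Z u = u ∈ₛ? W ×-dec ¬? (u ∈ₛ? Z)
      equal : ∀ {Z q} → ¬ (∃ λ z → z ∈ₛ Z × z ≢ q) → ∀ {z} → z ∈ₛ Z → z ≡ q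
      equal {q = q} ¬other {z} z∈Z with z ≟ q
      ... | yes e = e
      ... | no ne = contradiction (z , z∈Z , ne) ¬other
      remaining : ∀ {Z q z} v → q ∈ₛ Z → z ∈ₛ Z → z ≢ q → ∃ λ w → w ∈ₛ Z ∖ v
      remaining {q = q} {z} v q∈ z∈ z≢q with q ≟ v
      ... | yes refl = z , ∈-∖⁺ z∈ z≢q
      ... | no ne    = q , ∈-∖⁺ q∈ ne
      -- Vertices outside `Z` are reached as before, without using `v`. In particular `u` is
      -- reached, and then `v` by the arc from `u`.
      shrink : ∀ {Z u v} → Z ⊆ₛ T → Spans Z → u ∈ₛ W → u ∉ₛ Z → v ∈ₛ Z → Arc D u v → Spans (Z ∖ v)
      shrink {Z} {u} {v} Z⊆T spans u∈W u∉Z v∈Z a Y x∈Y Y⊆ closed {w} w∈W w∉ with w ≟ v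
      ... | yes refl = v∈Y
        where
        v∈Y : v ∈ₛ Y
        v∈Y with v ∈ₛ? Y
        ... | yes m = m
        ... | no v∉Y = closed (spans Y x∈Y (λ m → proj₁ (Y⊆ m) , λ m' → proj₂ (Y⊆ m) (∈-∖⁺ m' λ { refl → v∉Y m }))
                (λ a∈ b∈W b∉Z → closed a∈ b∈W (b∉Z ∘ proj₁ ∘ ∈-∖⁻)) u∈W u∉Z) (T⊆W (Z⊆T v∈Z)) (λ m → proj₂ (∈-∖⁻ m) refl) a
      ... | no w≢v = proj₁ (∈-∖⁻ (spans (Y ∖ v) (∈-∖⁺ x∈Y λ { refl → x∉T (Z⊆T v∈Z) })
              (λ m → proj₁ (Y⊆ (proj₁ (∈-∖⁻ m))) , λ m' → proj₂ (Y⊆ (proj₁ (∈-∖⁻ m))) (∈-∖⁺ m' (proj₂ (∈-∖⁻ m))))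
              (λ a∈ b∈W b∉Z arc → ∈-∖⁺ (closed (proj₁ (∈-∖⁻ a∈)) b∈W (b∉Z ∘ proj₁ ∘ ∈-∖⁻) arc) λ { refl → b∉Z v∈Z })
              w∈W (λ m → w∉ (∈-∖⁺ m w≢v))))

    module _ {q : V D} (q∈T : q ∈ₛ T) where

      Reach : V D → V D → Set
      Reach u v = ∃ λ xs → Trail u xs v × All (_∈ₛ W ∖ q) xs

      reach-step : ∀ {u v w} → Reach u v → Arc D v w → w ∈ₛ W ∖ q → Reach u w
      reach-step (xs , p , inW) a w∈ = xs ++ _ ∷ [] , trail-++ xs p (a , refl) , All.++⁺ inW (w∈ ∷ [])

      reach-trans : ∀ {u v w} → Reach u v → Reach v w → Reach u w
      reach-trans (xs , p , inP) (ys , r , inR) = xs ++ ys , trail-++ xs p r , All.++⁺ inP inR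

      q≢x : q ≢ x
      q≢x refl = x∉T q∈T

      -- `Spans` is applied to the set of vertices reached from `x`.
      reach-from-x : ∀ {Z} → q ∈ₛ Z → (∀ z → z ∈ₛ Z → z ≡ q) → Spans Z → ∀ {v} → v ∈ₛ W ∖ q → DN (Reach x v)
      reach-from-x {Z} q∈Z Z≡q spans {v} v∈ = do
        Y , Y⁺ , Y⁻ ← comprehension (λ v → v ∈ₛ W ∖ q × Reach x v)
        return (proj₂ (Y⁻ v (spans Y
          (Y⁺ x (∈-∖⁺ x∈W (q≢x ∘ sym) , [] , refl , []))
          (λ {u} m → proj₁ (∈-∖⁻ (proj₁ (Y⁻ u m))) , λ u∈Z → proj₂ (∈-∖⁻ (proj₁ (Y⁻ u m))) (Z≡q u u∈Z))
          (λ {u} {w} m w∈W w∉Z a → let w∈ = ∈-∖⁺ w∈W λ { refl → w∉Z q∈Z } in Y⁺ w (w∈ , reach-step (proj₂ (Y⁻ u m)) a w∈))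
          (proj₁ (∈-∖⁻ v∈)) (λ v∈Z → proj₂ (∈-∖⁻ v∈) (Z≡q v v∈Z)))))

      -- If no vertex reached from `y` in `T ∖ q` had an arc to `x`, these vertices could be left
      -- only towards `q` and would form a smaller piece.
      reach-to-x : ∀ {y} → y ∈ₛ T ∖ q → DN (Reach y x)
      reach-to-x {y} y∈ = do
        Y , Y⁺ , Y⁻ ← comprehension (λ v → v ∈ₛ T ∖ q × Reach y v)
        yes (u , u∈Y , a) ← em {∃ λ u → u ∈ₛ Y × Arc D u x}
          where no ¬exit → ⊥-elim (proj₂ min Y (smaller Y Y⁻) (record
                  { s∈T = Y⁺ y (y∈ , [] , refl , []) ; T⊆W = λ m → T⊆W (proj₁ (∈-∖⁻ (proj₁ (Y⁻ _ m)))) ; x∈W = T⊆W q∈T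
                  ; x∉T = λ m → proj₂ (∈-∖⁻ (proj₁ (Y⁻ q m))) refl
                  ; exit = λ u∈ v∈ a → exit-q Y Y⁺ Y⁻ ¬exit u∈ v∈ a }))
        return (reach-step (proj₂ (Y⁻ u u∈Y)) a (∈-∖⁺ x∈W (q≢x ∘ sym)))
        where
        smaller : ∀ Y → (∀ v → v ∈ₛ Y → v ∈ₛ T ∖ q × Reach y v) → Y ⊂ T
        smaller Y Y⁻ = (λ m → proj₁ (∈-∖⁻ (proj₁ (Y⁻ _ m)))) , q , q∈T , λ m → proj₂ (∈-∖⁻ (proj₁ (Y⁻ q m))) refl
        exit-q : ∀ Y → (∀ v → v ∈ₛ T ∖ q × Reach y v → v ∈ₛ Y) → (∀ v → v ∈ₛ Y → v ∈ₛ T ∖ q × Reach y v) →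
                 ¬ (∃ λ u → u ∈ₛ Y × Arc D u x) → OnlyExit D Y W q
        exit-q Y Y⁺ Y⁻ ¬exit {u} {v} u∈Y v∈W a with exit (proj₁ (∈-∖⁻ (proj₁ (Y⁻ u u∈Y)))) v∈W a | v ≟ q
        ... | _         | yes v≡q = inj₂ v≡q
        ... | inj₂ refl | no _    = contradiction (u , u∈Y , a) ¬exit
        ... | inj₁ v∈T  | no v≢q  = inj₁ (Y⁺ v (∈-∖⁺ v∈T v≢q , reach-step (proj₂ (Y⁻ u u∈Y)) a (∈-∖⁺ v∈W v≢q)))

      reach-from-out-neighbour : ∀ {h} → Arc D q h → h ∈ₛ W ∖ q → DN (Reach h x)
      reach-from-out-neighbour a h∈ with exit q∈T (proj₁ (∈-∖⁻ h∈)) a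
      ... | inj₁ h∈T  = reach-to-x (∈-∖⁺ h∈T (proj₂ (∈-∖⁻ h∈)))
      ... | inj₂ refl = return ([] , refl , [])


  module _ {S : Subset (size D)} {q : V D} (q∉S : q ∉ₛ S) {c : V D → Fin 3}
           (cycles : ∀ i → ∃ λ xs → DirectedCycle D q xs × All (_∈ₛ S) xs × All (λ w → c w ≡ i) xs) where

    Q : Fin 3 → List (V D)
    Q i = proj₁ (cycles i)

    Q-disjoint : ∀ {w i j} → w ∈ Q i → w ∈ Q j → i ≡ j
    Q-disjoint {i = i} {j} m m' = trans (sym (All.lookup (proj₂ (proj₂ (proj₂ (cycles i)))) m)) (All.lookup (proj₂ (proj₂ (proj₂ (cycles j)))) m')

    Q⊆S : ∀ i → All (_∈ₛ S) (Q i)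
    Q⊆S i = proj₁ (proj₂ (proj₂ (cycles i)))

    Q-head : ∀ i → ∃ λ h → Arc D q h × h ∈ Q i
    Q-head i with cycles i
    ... | []    , (a , _) , _       = contradiction a (arc-irrefl D)
    ... | h ∷ _ , ((a , _) , _) , _ = h , a , here refl

    segment⇒H₁ : Segment {P = _∈ₛ S} Q Q-disjoint → Subdivision H₁ D
    segment⇒H₁ record { i = i ; j = j ; w = w ; ws = ws ; i≢j = i≢j ; u∈Qi = u∈ ; v∈Qj = v∈ ; walk = a , p
                      ; inside = inside ; avoid-i = avoid-i ; avoid-j = avoid-j }
      -- Only the part after `w` is loop-erased, so `w` survives as the image of `d`. The cycle that
      -- the segment leaves becomes `C`, the one it enters `A`.
      with ys , p' , uniq , ys⊆ws ← loop-erase D ws p =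
      subdivision-H₁ (proj₁ (proj₂ (cycles j))) (proj₁ (proj₂ (cycles i))) v∈ u∈ (a , p')
        (∷-unique q∉ (Unique.++⁺ (tail j) (Unique.++⁺ (tail i) uniq λ (m , m') → All.lookup avoid-i (⊆-ws m') m)
          λ {z} (m , m') → [ (λ m″ → i≢j (Q-disjoint m″ m)) , (λ m″ → All.lookup avoid-j (⊆-ws m″) m) ]′ (∈-++⁻ (Q i) m')))
      where
      tail : ∀ i → Unique (Q i)
      tail i with _ ∷ u ← proj₂ (proj₁ (proj₂ (cycles i))) = u
      ⊆-ws : ∀ {z} → z ∈ w ∷ ys → z ∈ w ∷ ws
      ⊆-ws (here e)  = here e
      ⊆-ws (there m) = there (ys⊆ws m)
      q∉ : q ∉ Q j ++ Q i ++ w ∷ ys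
      q∉ m with ∈-++⁻ (Q j) m
      ... | inj₁ mj = q∉S (All.lookup (Q⊆S j) mj)
      ... | inj₂ m' with ∈-++⁻ (Q i) m'
      ...   | inj₁ mi = q∉S (All.lookup (Q⊆S i) mi)
      ...   | inj₂ mw = q∉S (All.lookup inside (⊆-ws mw))

critical⇒H₁ : ∀ D {W} → Critical D 3 W → DN (Subdivision H₁ D)
critical⇒H₁ D {W} crit = do
  T , min ← minimal-piece D crit
  let open Piece (proj₁ min)
  q , q∈T , Z , q∈Z , Z≡q , spans ← single-unspanned D crit min
  c , col ← critical-proper D crit (∖-⊂ (T⊆W q∈T))
  cycles ← DN-∀ (cycle-through D (proj₁ crit) col)
  let q∉ : q ∉ₛ W ∖ q
      q∉ m = proj₂ (∈-∖⁻ m) refl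
      h : Fin 3 → V D
      h i = proj₁ (Q-head D q∉ cycles i)
      q→h : ∀ i → Arc D q (h i)
      q→h i = proj₁ (proj₂ (Q-head D q∉ cycles i))
      h∈Q : ∀ i → h i ∈ Q D q∉ cycles i
      h∈Q i = proj₂ (proj₂ (Q-head D q∉ cycles i))
      h∈S : ∀ i → h i ∈ₛ W ∖ q
      h∈S i = All.lookup (Q⊆S D q∉ cycles i) (h∈Q i)
      h↝x : ∀ i → DN (Reach D crit min q∈T (h i) x)
      h↝x i = reach-from-out-neighbour D crit min q∈T (q→h i) (h∈S i)
      x↝h : ∀ i → DN (Reach D crit min q∈T x (h i))
      x↝h i = reach-from-x D crit min q∈T q∈Z Z≡q spans (h∈S i)
  -- The trail from `h zero` through `x`, `h (suc zero)` and `x` again to the third `h` meets all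
  -- three cycles.
  h₀↝x ← h↝x zero
  x↝h₁ ← x↝h (suc zero)
  h₁↝x ← h↝x (suc zero)
  x↝h₂ ← x↝h (suc (suc zero))
  let xs , p , inP = reach-trans D crit min q∈T h₀↝x x↝h₁
      ys , r , inR = reach-trans D crit min q∈T h₁↝x x↝h₂
      meets : ∀ i → Meets D {P = _∈ₛ W ∖ q} (Q D q∉ cycles) (Q-disjoint D q∉ cycles) (h zero ∷ xs ++ ys) i
      meets = λ { zero → here (h∈Q zero)
                ; (suc zero) → lose (∈-++⁺ˡ (trail-end D xs p)) (h∈Q (suc zero))
                ; (suc (suc zero)) → lose (trail-end D (xs ++ ys) (trail-++ D xs p r)) (h∈Q (suc (suc zero))) }
  return (segment⇒H₁ D q∉ cycles (segment D _ _ (xs ++ ys) (trail-++ D xs p r) (All.++⁺ inP inR) meets))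

-- From critical sets to the theorem

critical-subset : ∀ {D k} → ¬ AcyclicColorable D k → DN (∃ (Critical D k))
critical-subset {D} {k} ¬col = minimal (λ S → ¬ Colourable D k S) ⊤ₛ
  λ (c , col) → ¬col (c , λ x xs cyc → col x xs cyc (All.tabulate λ _ → ∈⊤))

critical⇒mader : ∀ {H k} → (∀ D {W} → Critical D k W → DN (Subdivision H D)) → MaderProperty H (suc k)
critical⇒mader {H} {k} contains D j (_ , fewer) k<j = decidable-stable (subdivision? H D) (do
  _ , crit ← critical-subset (fewer k k<j)
  contains D crit)

theorem4p1 : IsMaderChi H₁ 4 × IsMaderChi H₂ 4
theorem4p1 = (critical⇒mader critical⇒H₁ , mader-size H₁) , (critical⇒mader critical⇒H₂ , mader-size H₂)
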